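{- Let $\Gamma$ be a context, $M,N$ objects and $A$ a type. If $\Gamma\vdash M=N:A$ then $\Gamma^-\vdash M\Leftrightarrow N:A^-$.
   Context: **Syntax of $\lambda^{\Pi N}$.** Fix countable, pairwise disjoint sets of variables $x,y$, names $\mathsf a,\mathsf b$, object constants $c$, type constants $a$, and name-type constants $\alpha,\beta$. Kinds: $K::=\mathrm{type}\mid\Pi x{:}A.K$. Types (type families): $A,B::=a\mid A\,M\mid\Pi x{:}A.B\mid\alpha\mid\mathrm{New}\,\mathsf a{:}\alpha.B$. Objects: $M,N::=c\mid x\mid\lambda x{:}A.M\mid M\,N\mid\mathsf a\mid\langle\mathsf a{:}\alpha\rangle M\mid M@\mathsf a$. Signatures: $\Sigma::=\cdot\mid\Sigma,c{:}A\mid\Sigma,a{:}K\mid\Sigma,\alpha{:}\mathrm{name}$. Contexts: $\Gamma::=\cdot\mid\Gamma,x{:}A\mid\Gamma\#\mathsf a{:}\alpha$. $\Pi,\lambda$ bind $x$; $\mathrm{New}$ and $\langle\mathsf a{:}\alpha\rangle$ bind $\mathsf a$; expressions are identified up to renaming of bound variables and names, and $[M/x]$, $[\mathsf b/\mathsf a]$ are capture-avoiding. Items declared in a signature or context are distinct. All judgments except signature formation are implicitly parametrized by a signature $\Sigma$; signatures and contexts are implicitly well-formed and bound variables/names implicitly fresh. **Restriction** $\Gamma\vdash\mathsf a{:}\alpha\backslash\Gamma'$ (inductively): $\Gamma\#\mathsf a{:}\alpha\vdash\mathsf a{:}\alpha\backslash\Gamma$; if $\Gamma\vdash\mathsf a{:}\alpha\backslash\Gamma'$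 then $\Gamma\#\mathsf b{:}\beta\vdash\mathsf a{:}\alpha\backslash\Gamma'\#\mathsf b{:}\beta$ and $\Gamma,x{:}A\vdash\mathsf a{:}\alpha\backslash\Gamma'$. **Formation.** Signatures: $\cdot$ is well-formed; a well-formed $\Sigma$ may be extended by $a{:}K$ if $\cdot\vdash K:\mathrm{kind}$, by $c{:}A$ if $\cdot\vdash A:\mathrm{type}$, by $\alpha{:}\mathrm{name}$ always. Contexts: $\cdot$ is well-formed; a well-formed $\Gamma$ may be extended by $x{:}A$ if $\Gamma\vdash A:\mathrm{type}$, by $\#\mathsf a{:}\alpha$ if $\alpha{:}\mathrm{name}\in\Sigma$. Kinds: $\Gamma\vdash\mathrm{type}:\mathrm{kind}$; if $\Gamma\vdash A:\mathrm{type}$ and $\Gamma,x{:}A\vdash K:\mathrm{kind}$ then $\Gamma\vdash\Pi x{:}A.K:\mathrm{kind}$. Types: $\Gamma\vdash a:K$ if $a{:}K\in\Sigma$; $\Gamma\vdash A\,M:K[M/x]$ if $\Gamma\vdash A:\Pi x{:}B.K$ and $\Gamma\vdash M:B$; $\Gamma\vdash\Pi x{:}A.B:\mathrm{type}$ if $\Gamma\vdash A:\mathrm{type}$ and $\Gamma,x{:}A\vdash B:\mathrm{type}$; $\Gamma\vdash\alpha:\mathrm{type}$ if $\alpha{:}\mathrm{name}\in\Sigma$; $\Gamma\vdash\mathrm{New}\,\mathsf a{:}\alpha.B:\mathrm{type}$ if $\alpha{:}\mathrm{name}\in\Sigma$ and $\Gamma\#\mathsf a{:}\alpha\vdash B:\mathrm{type}$;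 conversion: $\Gamma\vdash A:K'$ and $\Gamma\vdash K=K':\mathrm{kind}$ give $\Gamma\vdash A:K$. Objects: $\Gamma\vdash c:A$ if $c{:}A\in\Sigma$; $\Gamma\vdash x:A$ if $x{:}A\in\Gamma$; $\Gamma\vdash\mathsf a:\alpha$ if $\mathsf a{:}\alpha\in\Gamma$; $\Gamma\vdash\lambda x{:}A.M:\Pi x{:}A.B$ if $\Gamma\vdash A:\mathrm{type}$ and $\Gamma,x{:}A\vdash M:B$; $\Gamma\vdash M\,N:B[N/x]$ if $\Gamma\vdash M:\Pi x{:}A.B$ and $\Gamma\vdash N:A$; $\Gamma\vdash\langle\mathsf a{:}\alpha\rangle M:\mathrm{New}\,\mathsf a{:}\alpha.B$ if $\alpha{:}\mathrm{name}\in\Sigma$ and $\Gamma\#\mathsf a{:}\alpha\vdash M:B$; $\Gamma\vdash M@\mathsf a:B$ if $\Gamma\vdash\mathsf a{:}\alpha\backslash\Gamma'$ and $\Gamma'\vdash M:\mathrm{New}\,\mathsf a{:}\alpha.B$; conversion: $\Gamma\vdash M:A$ and $\Gamma\vdash A=B:\mathrm{type}$ give $\Gamma\vdash M:B$. **Definitional equality.** Standard LF rules. At each of the three levels: symmetry and transitivity; at the object (type) level conversion along an equal type (kind). Kinds: $\mathrm{type}=\mathrm{type}$; $\Pi x{:}A.K=\Pi x{:}B.L$ if $\Gamma\vdash A:\mathrm{type}$, $\Gamma\vdash A=B:\mathrm{type}$ and $\Gamma,x{:}A\vdash K=L:\mathrm{kind}$. Types: $a=a:K$ if $a{:}K\in\Sigma$;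 $A\,M=B\,N:K[M/x]$ if $A=B:\Pi x{:}C.K$ and $M=N:C$; $\Pi x{:}A_1.A_2=\Pi x{:}B_1.B_2:\mathrm{type}$ if $\Gamma\vdash A_1:\mathrm{type}$, $A_1=B_1:\mathrm{type}$ and $\Gamma,x{:}A_1\vdash A_2=B_2:\mathrm{type}$. Objects: $x=x:A$ and $c=c:A$ for declared $x{:}A$, $c{:}A$; $M_1M_2=N_1N_2:B[M_2/x]$ if $M_1=N_1:\Pi x{:}A.B$ and $M_2=N_2:A$; $\lambda x{:}A'.M=\lambda x{:}A''.N:\Pi x{:}A.B$ if $A'=A:\mathrm{type}$, $A''=A:\mathrm{type}$ and $\Gamma,x{:}A\vdash M=N:B$; $(\lambda x{:}A.M_2)M_1=N_2[N_1/x]:B[M_1/x]$ if $\Gamma\vdash A:\mathrm{type}$, $\Gamma,x{:}A\vdash M_2=N_2:B$ and $M_1=N_1:A$; $M=N:\Pi x{:}A.B$ if $\Gamma\vdash A:\mathrm{type}$, $\Gamma\vdash M:\Pi x{:}A.B$, $\Gamma\vdash N:\Pi x{:}A.B$ and $\Gamma,x{:}A\vdash M\,x=N\,x:B$. Additional rules: $A_1=A_2:\Pi x{:}B.K$ if $\Gamma,x{:}B\vdash A_1\,x=A_2\,x:K$; $\alpha=\alpha:\mathrm{type}$ if $\alpha{:}\mathrm{name}\in\Sigma$; $\mathrm{New}\,\mathsf a{:}\alpha.A=\mathrm{New}\,\mathsf a{:}\alpha.B:\mathrm{type}$ if $\Gamma\#\mathsf a{:}\alpha\vdash A=B:\mathrm{type}$;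 $\mathsf a=\mathsf a:\alpha$ if $\mathsf a{:}\alpha\in\Gamma$; $\langle\mathsf a{:}\alpha\rangle M=\langle\mathsf a{:}\alpha\rangle N:\mathrm{New}\,\mathsf a{:}\alpha.A$ if $\Gamma\#\mathsf a{:}\alpha\vdash M=N:A$; $M@\mathsf b=N@\mathsf b:A[\mathsf b/\mathsf a]$ if $\Gamma\vdash\mathsf b{:}\alpha\backslash\Gamma'$ and $\Gamma'\vdash M=N:\mathrm{New}\,\mathsf a{:}\alpha.A$; $(\langle\mathsf a{:}\alpha\rangle M)@\mathsf b=N[\mathsf b/\mathsf a]:A[\mathsf b/\mathsf a]$ if $\Gamma\vdash\mathsf b{:}\alpha\backslash\Gamma'$ and $\Gamma'\#\mathsf a{:}\alpha\vdash M=N:A$; $M=N:\mathrm{New}\,\mathsf a{:}\alpha.A$ if $\Gamma\#\mathsf a{:}\alpha\vdash M@\mathsf a=N@\mathsf a:A$. **Erasure.** Simple types $\tau::=a^-\mid\tau\to\tau'\mid\langle\alpha\rangle\tau\mid\alpha$. Erasure: type constant $a\mapsto a^-$, $(A\,M)^-=A^-$, $(\Pi x{:}A.B)^-=A^-\to B^-$, $(\alpha)^-=\alpha$, $(\mathrm{New}\,\mathsf a{:}\alpha.A)^-=\langle\alpha\rangle A^-$. Simple contexts $\Delta::=\cdot\mid\Delta,x{:}\tau\mid\Delta\#\mathsf a{:}\alpha$; $\Gamma^-$ erases each type in $\Gamma$. Restriction $\Delta\vdash\mathsf a{:}\alpha\backslash\Delta'$ is defined by the same three rules for simple contexts. **Weak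 head reduction** $M\to_{wh}M'$: $(\lambda x{:}A.M)N\to_{wh}M[N/x]$; $(\langle\mathsf a{:}\alpha\rangle M)@\mathsf b\to_{wh}M[\mathsf b/\mathsf a]$; if $M\to_{wh}M'$ then $M\,N\to_{wh}M'\,N$ and $M@\mathsf a\to_{wh}M'@\mathsf a$. **Algorithmic equivalence** $\Delta\vdash M\Leftrightarrow N:\tau$ and **structural equivalence** $\Delta\vdash M\leftrightarrow N:\tau$ (mutually inductive). For $\delta$ of the form $a^-$ or $\alpha$: $M\Leftrightarrow N:\delta$ if $M\to_{wh}M'$ and $M'\Leftrightarrow N:\delta$; or $N\to_{wh}N'$ and $M\Leftrightarrow N':\delta$; or $M\leftrightarrow N:\delta$. $\Delta\vdash M\Leftrightarrow N:\tau_1\to\tau_2$ if $\Delta,x{:}\tau_1\vdash M\,x\Leftrightarrow N\,x:\tau_2$ ($x$ fresh); $\Delta\vdash M\Leftrightarrow N:\langle\alpha\rangle\tau$ if $\Delta\#\mathsf a{:}\alpha\vdash M@\mathsf a\Leftrightarrow N@\mathsf a:\tau$ ($\mathsf a$ fresh). $\Delta\vdash x\leftrightarrow x:\tau$ if $x{:}\tau\in\Delta$; $c\leftrightarrow c:A^-$ if $c{:}A\in\Sigma$; $\mathsf a\leftrightarrow\mathsf a:\alpha$ if $\mathsf a{:}\alpha\in\Delta$; $M_1M_2\leftrightarrow N_1N_2:\tau_2$ if $\Delta\vdash M_1\leftrightarrow N_1:\tau_1\to\tau_2$ and $\Delta\vdash M_2\Leftrightarrow N_2:\tau_1$; $M@\mathsf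 a\leftrightarrow N@\mathsf a:\tau$ if $\Delta\vdash\mathsf a{:}\alpha\backslash\Delta'$ and $\Delta'\vdash M\leftrightarrow N:\langle\alpha\rangle\tau$. -}

module Defs where

open import Data.List using (List; []; _∷_)
open import Data.List.Membership.Propositional using (_∈_; _∉_)
open import Data.Nat using (ℕ)

infix  20 _▸_ _#_
infix  30 _⁻ _⁻ᶜ
infixl 25 _·_ _·ᵗ_ _＠_
infixr 24 _⇒_
infix  22 _[_] _[_]ᵗ _[_]ᵏ _[_]ⁿ _[_]ⁿᵗ

-- Expressions up to renaming of bound variables and names are represented by
-- well-scoped de Bruijn terms.  Variables and names are declared in one
-- interleaved context, so they share a scope whose entries are tagged by sort.

data Sort : Set where
  vr nm : Sort

Scope : Set
Scope = List Sort

data _∋_ : Scope → Sort → Set where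
  zero : ∀ {s k}           → (k ∷ s) ∋ k
  suc  : ∀ {s k l} → s ∋ k → (l ∷ s) ∋ k

-- The three classes of constants are disjoint because they enter the syntax
-- through different constructors.

OConst TConst NConst : Set
OConst = ℕ
TConst = ℕ
NConst = ℕ

mutual
  data Kind (s : Scope) : Set where
    type : Kind s
    Πᵏ   : Ty s → Kind (vr ∷ s) → Kind s

  data Ty (s : Scope) : Set where
    con  : TConst → Ty s
    _·ᵗ_ : Ty s → Obj s → Ty s
    Π    : Ty s → Ty (vr ∷ s) → Ty s
    name : NConst → Ty s
    New  : NConst → Ty (nm ∷ s) → Ty s

  data Obj (s : Scope) : Set where
    con  : OConst → Obj s
    var  : s ∋ vr → Obj s
    ƛ    : Ty s → Obj (vr ∷ s) → Obj s
    _·_  : Obj s → Obj s → Obj s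
    name : s ∋ nm → Obj s
    ⟨_⟩_ : NConst → Obj (nm ∷ s) → Obj s
    _＠_ : Obj s → s ∋ nm → Obj s

------------------------------------------------------------------------
-- Renaming and substitution

Ren : Scope → Scope → Set
Ren s t = ∀ {k} → s ∋ k → t ∋ k

liftʳ : ∀ {s t l} → Ren s t → Ren (l ∷ s) (l ∷ t)
liftʳ ρ zero    = zero
liftʳ ρ (suc i) = suc (ρ i)

mutual
  renᵏ : ∀ {s t} → Ren s t → Kind s → Kind t
  renᵏ ρ type     = type
  renᵏ ρ (Πᵏ A K) = Πᵏ (renᵗ ρ A) (renᵏ (liftʳ ρ) K)

  renᵗ : ∀ {s t} → Ren s t → Ty s → Ty t
  renᵗ ρ (con a)   = con a
  renᵗ ρ (A ·ᵗ M)  = renᵗ ρ A ·ᵗ ren ρ M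
  renᵗ ρ (Π A B)   = Π (renᵗ ρ A) (renᵗ (liftʳ ρ) B)
  renᵗ ρ (name α)  = name α
  renᵗ ρ (New α B) = New α (renᵗ (liftʳ ρ) B)

  ren : ∀ {s t} → Ren s t → Obj s → Obj t
  ren ρ (con c)   = con c
  ren ρ (var x)   = var (ρ x)
  ren ρ (ƛ A M)   = ƛ (renᵗ ρ A) (ren (liftʳ ρ) M)
  ren ρ (M · N)   = ren ρ M · ren ρ N
  ren ρ (name a)  = name (ρ a)
  ren ρ (⟨ α ⟩ M) = ⟨ α ⟩ ren (liftʳ ρ) M
  ren ρ (M ＠ a)  = ren ρ M ＠ ρ a

wk : ∀ {s l} → Obj s → Obj (l ∷ s)
wk = ren suc

wkᵗ : ∀ {s l} → Ty s → Ty (l ∷ s)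
wkᵗ = renᵗ suc

∅ : ∀ {s} → Ren [] s
∅ ()

-- A substitution sends variables to objects but names only to names.

Img : Sort → Scope → Set
Img vr t = Obj t
Img nm t = t ∋ nm

Sub : Scope → Scope → Set
Sub s t = ∀ {k} → s ∋ k → Img k t

fromIndex : ∀ k {t} → t ∋ k → Img k t
fromIndex vr x = var x
fromIndex nm a = a

wkImg : ∀ k {t l} → Img k t → Img k (l ∷ t)
wkImg vr M = wk M
wkImg nm a = suc a

liftˢ : ∀ {s t l} → Sub s t → Sub (l ∷ s) (l ∷ t)
liftˢ σ {k} zero    = fromIndex k zero
liftˢ σ {k} (suc i) = wkImg k (σ i)

mutual
  subᵏ : ∀ {s t} → Sub s t → Kind s → Kind t
  subᵏ σ type     = type
  subᵏ σ (Πᵏ A K) = Πᵏ (subᵗ σ A) (subᵏ (liftˢ σ) K)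

  subᵗ : ∀ {s t} → Sub s t → Ty s → Ty t
  subᵗ σ (con a)   = con a
  subᵗ σ (A ·ᵗ M)  = subᵗ σ A ·ᵗ sub σ M
  subᵗ σ (Π A B)   = Π (subᵗ σ A) (subᵗ (liftˢ σ) B)
  subᵗ σ (name α)  = name α
  subᵗ σ (New α B) = New α (subᵗ (liftˢ σ) B)

  sub : ∀ {s t} → Sub s t → Obj s → Obj t
  sub σ (con c)   = con c
  sub σ (var x)   = σ x
  sub σ (ƛ A M)   = ƛ (subᵗ σ A) (sub (liftˢ σ) M)
  sub σ (M · N)   = sub σ M · sub σ N
  sub σ (name a)  = name (σ a)
  sub σ (⟨ α ⟩ M) = ⟨ α ⟩ sub (liftˢ σ) M
  sub σ (M ＠ a)  = sub σ M ＠ σ a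

inst : ∀ {s} → Obj s → Sub (vr ∷ s) s
inst M     zero    = M
inst M {k} (suc i) = fromIndex k i

_[_] : ∀ {s} → Obj (vr ∷ s) → Obj s → Obj s
N [ M ] = sub (inst M) N

_[_]ᵗ : ∀ {s} → Ty (vr ∷ s) → Obj s → Ty s
B [ M ]ᵗ = subᵗ (inst M) B

_[_]ᵏ : ∀ {s} → Kind (vr ∷ s) → Obj s → Kind s
K [ M ]ᵏ = subᵏ (inst M) K

instⁿ : ∀ {s} → s ∋ nm → Ren (nm ∷ s) s
instⁿ b zero    = b
instⁿ b (suc i) = i

_[_]ⁿ : ∀ {s} → Obj (nm ∷ s) → s ∋ nm → Obj s
M [ b ]ⁿ = ren (instⁿ b) M

_[_]ⁿᵗ : ∀ {s} → Ty (nm ∷ s) → s ∋ nm → Ty s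
B [ b ]ⁿᵗ = renᵗ (instⁿ b) B

------------------------------------------------------------------------
-- Signatures and contexts

data Decl : Set where
  _∶ᵒ_  : OConst → Ty [] → Decl
  _∶ᵗ_  : TConst → Kind [] → Decl
  _∶name : NConst → Decl

Sig : Set
Sig = List Decl

-- Ordinary and simple contexts differ only in what is assigned to variables.

data Cx (T : Scope → Set) : Scope → Set where
  ε   : Cx T []
  _▸_ : ∀ {s} → Cx T s → T s → Cx T (vr ∷ s)
  _#_ : ∀ {s} → Cx T s → NConst → Cx T (nm ∷ s)

Ctx : Scope → Set
Ctx = Cx Ty

data _∋ᵛ_∶_ : ∀ {s} → Ctx s → s ∋ vr → Ty s → Set where
  here   : ∀ {s} {Γ : Ctx s} {A} → (Γ ▸ A) ∋ᵛ zero ∶ wkᵗ A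
  there▸ : ∀ {s} {Γ : Ctx s} {A B x} → Γ ∋ᵛ x ∶ A → (Γ ▸ B) ∋ᵛ suc x ∶ wkᵗ A
  there# : ∀ {s} {Γ : Ctx s} {A β x} → Γ ∋ᵛ x ∶ A → (Γ # β) ∋ᵛ suc x ∶ wkᵗ A

data _∋ⁿ_∶_ {T : Scope → Set} : ∀ {s} → Cx T s → s ∋ nm → NConst → Set where
  here   : ∀ {s} {Γ : Cx T s} {α} → (Γ # α) ∋ⁿ zero ∶ α
  there▸ : ∀ {s} {Γ : Cx T s} {B α a} → Γ ∋ⁿ a ∶ α → (Γ ▸ B) ∋ⁿ suc a ∶ α
  there# : ∀ {s} {Γ : Cx T s} {β α a} → Γ ∋ⁿ a ∶ α → (Γ # β) ∋ⁿ suc a ∶ α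

-- s ∖ a is the scope of the context obtained by restricting at a: the name a
-- and all variables declared after it are dropped, later names are kept.

_∖_ : (s : Scope) → s ∋ nm → Scope
(_ ∷ s)  ∖ zero  = s
(vr ∷ s) ∖ suc a = s ∖ a
(nm ∷ s) ∖ suc a = nm ∷ (s ∖ a)

-- The inclusion of the restricted scope.  With names it would be silent: an
-- expression over a restricted context is also one over the full context.

thin : ∀ {s} (a : s ∋ nm) → Ren (s ∖ a) s
thin           zero    i       = suc i
thin {vr ∷ _} (suc a)  i       = suc (thin a i)
thin {nm ∷ _} (suc a)  zero    = zero
thin {nm ∷ _} (suc a)  (suc i) = suc (thin a i)

data _⊢_∶_⧵_ {T : Scope → Set} :
    ∀ {s} → Cx T s → (a : s ∋ nm) → NConst → Cx T (s ∖ a) → Set where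
  here   : ∀ {s} {Γ : Cx T s} {α} → (Γ # α) ⊢ zero ∶ α ⧵ Γ
  there# : ∀ {s} {Γ : Cx T s} {a α Γ′ β} →
           Γ ⊢ a ∶ α ⧵ Γ′ → (Γ # β) ⊢ suc a ∶ α ⧵ (Γ′ # β)
  there▸ : ∀ {s} {Γ : Cx T s} {a α Γ′ A} →
           Γ ⊢ a ∶ α ⧵ Γ′ → (Γ ▸ A) ⊢ suc a ∶ α ⧵ Γ′

------------------------------------------------------------------------
-- Formation and definitional equality

-- The convention that contexts in judgments are well-formed is made explicit:
-- a rule has a premise Σ ⊢ᶜ Γ whenever none of its other premises is a
-- judgment over Γ or an extension of Γ.  In a rule for M ＠ b the objects live
-- over the restricted scope and are brought into the full one by thin b.

mutual
  data _⊢ᶜ_ (Σ : Sig) : ∀ {s} → Ctx s → Set where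
    ε   : Σ ⊢ᶜ ε
    _▸_ : ∀ {s} {Γ : Ctx s} {A} → Σ ⊢ᶜ Γ → Σ ∣ Γ ⊢ᵗ A ∶ type → Σ ⊢ᶜ (Γ ▸ A)
    _#_ : ∀ {s} {Γ : Ctx s} {α} → Σ ⊢ᶜ Γ → (α ∶name) ∈ Σ → Σ ⊢ᶜ (Γ # α)

  data _∣_⊢ᵏ_ (Σ : Sig) {s} (Γ : Ctx s) : Kind s → Set where
    type : Σ ⊢ᶜ Γ → Σ ∣ Γ ⊢ᵏ type
    Πᵏ   : ∀ {A K} →
           Σ ∣ Γ ⊢ᵗ A ∶ type → Σ ∣ Γ ▸ A ⊢ᵏ K → Σ ∣ Γ ⊢ᵏ Πᵏ A K

  data _∣_⊢ᵗ_∶_ (Σ : Sig) {s} (Γ : Ctx s) : Ty s → Kind s → Set where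
    con  : ∀ {a K} → Σ ⊢ᶜ Γ → (a ∶ᵗ K) ∈ Σ → Σ ∣ Γ ⊢ᵗ con a ∶ renᵏ ∅ K
    app  : ∀ {A B K M} →
           Σ ∣ Γ ⊢ᵗ A ∶ Πᵏ B K → Σ ∣ Γ ⊢ᵒ M ∶ B → Σ ∣ Γ ⊢ᵗ A ·ᵗ M ∶ K [ M ]ᵏ
    Π    : ∀ {A B} →
           Σ ∣ Γ ⊢ᵗ A ∶ type → Σ ∣ Γ ▸ A ⊢ᵗ B ∶ type → Σ ∣ Γ ⊢ᵗ Π A B ∶ type
    name : ∀ {α} → Σ ⊢ᶜ Γ → (α ∶name) ∈ Σ → Σ ∣ Γ ⊢ᵗ name α ∶ type
    New  : ∀ {α B} →
           (α ∶name) ∈ Σ → Σ ∣ Γ # α ⊢ᵗ B ∶ type → Σ ∣ Γ ⊢ᵗ New α B ∶ type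
    conv : ∀ {A K K′} →
           Σ ∣ Γ ⊢ᵗ A ∶ K′ → Σ ∣ Γ ⊢ᵏ K ≐ K′ → Σ ∣ Γ ⊢ᵗ A ∶ K

  data _∣_⊢ᵒ_∶_ (Σ : Sig) {s} (Γ : Ctx s) : Obj s → Ty s → Set where
    con  : ∀ {c A} → Σ ⊢ᶜ Γ → (c ∶ᵒ A) ∈ Σ → Σ ∣ Γ ⊢ᵒ con c ∶ renᵗ ∅ A
    var  : ∀ {x A} → Σ ⊢ᶜ Γ → Γ ∋ᵛ x ∶ A → Σ ∣ Γ ⊢ᵒ var x ∶ A
    name : ∀ {a α} → Σ ⊢ᶜ Γ → Γ ∋ⁿ a ∶ α → Σ ∣ Γ ⊢ᵒ name a ∶ name α
    lam  : ∀ {A B M} →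
           Σ ∣ Γ ⊢ᵗ A ∶ type → Σ ∣ Γ ▸ A ⊢ᵒ M ∶ B → Σ ∣ Γ ⊢ᵒ ƛ A M ∶ Π A B
    app  : ∀ {A B M N} →
           Σ ∣ Γ ⊢ᵒ M ∶ Π A B → Σ ∣ Γ ⊢ᵒ N ∶ A → Σ ∣ Γ ⊢ᵒ M · N ∶ B [ N ]ᵗ
    abs  : ∀ {α B M} →
           (α ∶name) ∈ Σ → Σ ∣ Γ # α ⊢ᵒ M ∶ B → Σ ∣ Γ ⊢ᵒ ⟨ α ⟩ M ∶ New α B
    conc : ∀ {a α Γ′ B M} →
           Σ ⊢ᶜ Γ → Γ ⊢ a ∶ α ⧵ Γ′ → Σ ∣ Γ′ ⊢ᵒ M ∶ New α B →
           Σ ∣ Γ ⊢ᵒ ren (thin a) M ＠ a ∶ renᵗ (liftʳ (thin a)) B [ a ]ⁿᵗ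
    conv : ∀ {A B M} →
           Σ ∣ Γ ⊢ᵒ M ∶ A → Σ ∣ Γ ⊢ᵗ A ≐ B ∶ type → Σ ∣ Γ ⊢ᵒ M ∶ B

  data _∣_⊢ᵏ_≐_ (Σ : Sig) {s} (Γ : Ctx s) : Kind s → Kind s → Set where
    ≐-sym   : ∀ {K L} → Σ ∣ Γ ⊢ᵏ K ≐ L → Σ ∣ Γ ⊢ᵏ L ≐ K
    ≐-trans : ∀ {K₁ K₂ K₃} →
              Σ ∣ Γ ⊢ᵏ K₁ ≐ K₂ → Σ ∣ Γ ⊢ᵏ K₂ ≐ K₃ → Σ ∣ Γ ⊢ᵏ K₁ ≐ K₃
    type    : Σ ⊢ᶜ Γ → Σ ∣ Γ ⊢ᵏ type ≐ type
    Πᵏ      : ∀ {A B K L} →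
              Σ ∣ Γ ⊢ᵗ A ∶ type → Σ ∣ Γ ⊢ᵗ A ≐ B ∶ type →
              Σ ∣ Γ ▸ A ⊢ᵏ K ≐ L → Σ ∣ Γ ⊢ᵏ Πᵏ A K ≐ Πᵏ B L

  data _∣_⊢ᵗ_≐_∶_ (Σ : Sig) {s} (Γ : Ctx s) : Ty s → Ty s → Kind s → Set where
    ≐-sym   : ∀ {A B K} → Σ ∣ Γ ⊢ᵗ A ≐ B ∶ K → Σ ∣ Γ ⊢ᵗ B ≐ A ∶ K
    ≐-trans : ∀ {A B C K} →
              Σ ∣ Γ ⊢ᵗ A ≐ B ∶ K → Σ ∣ Γ ⊢ᵗ B ≐ C ∶ K → Σ ∣ Γ ⊢ᵗ A ≐ C ∶ K
    conv    : ∀ {A B K L} →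
              Σ ∣ Γ ⊢ᵗ A ≐ B ∶ K → Σ ∣ Γ ⊢ᵏ K ≐ L → Σ ∣ Γ ⊢ᵗ A ≐ B ∶ L
    con     : ∀ {a K} →
              Σ ⊢ᶜ Γ → (a ∶ᵗ K) ∈ Σ → Σ ∣ Γ ⊢ᵗ con a ≐ con a ∶ renᵏ ∅ K
    app     : ∀ {A B C K M N} →
              Σ ∣ Γ ⊢ᵗ A ≐ B ∶ Πᵏ C K → Σ ∣ Γ ⊢ᵒ M ≐ N ∶ C →
              Σ ∣ Γ ⊢ᵗ A ·ᵗ M ≐ B ·ᵗ N ∶ K [ M ]ᵏ
    Π       : ∀ {A₁ A₂ B₁ B₂} →
              Σ ∣ Γ ⊢ᵗ A₁ ∶ type → Σ ∣ Γ ⊢ᵗ A₁ ≐ B₁ ∶ type →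
              Σ ∣ Γ ▸ A₁ ⊢ᵗ A₂ ≐ B₂ ∶ type →
              Σ ∣ Γ ⊢ᵗ Π A₁ A₂ ≐ Π B₁ B₂ ∶ type
    ext     : ∀ {A₁ A₂ B K} →
              Σ ∣ Γ ▸ B ⊢ᵗ wkᵗ A₁ ·ᵗ var zero ≐ wkᵗ A₂ ·ᵗ var zero ∶ K →
              Σ ∣ Γ ⊢ᵗ A₁ ≐ A₂ ∶ Πᵏ B K
    name    : ∀ {α} →
              Σ ⊢ᶜ Γ → (α ∶name) ∈ Σ → Σ ∣ Γ ⊢ᵗ name α ≐ name α ∶ type
    New     : ∀ {α A B} →
              Σ ∣ Γ # α ⊢ᵗ A ≐ B ∶ type → Σ ∣ Γ ⊢ᵗ New α A ≐ New α B ∶ type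

  data _∣_⊢ᵒ_≐_∶_ (Σ : Sig) {s} (Γ : Ctx s) : Obj s → Obj s → Ty s → Set where
    ≐-sym   : ∀ {M N A} → Σ ∣ Γ ⊢ᵒ M ≐ N ∶ A → Σ ∣ Γ ⊢ᵒ N ≐ M ∶ A
    ≐-trans : ∀ {M N P A} →
              Σ ∣ Γ ⊢ᵒ M ≐ N ∶ A → Σ ∣ Γ ⊢ᵒ N ≐ P ∶ A → Σ ∣ Γ ⊢ᵒ M ≐ P ∶ A
    conv    : ∀ {M N A B} →
              Σ ∣ Γ ⊢ᵒ M ≐ N ∶ A → Σ ∣ Γ ⊢ᵗ A ≐ B ∶ type → Σ ∣ Γ ⊢ᵒ M ≐ N ∶ B
    var     : ∀ {x A} → Σ ⊢ᶜ Γ → Γ ∋ᵛ x ∶ A → Σ ∣ Γ ⊢ᵒ var x ≐ var x ∶ A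
    con     : ∀ {c A} →
              Σ ⊢ᶜ Γ → (c ∶ᵒ A) ∈ Σ → Σ ∣ Γ ⊢ᵒ con c ≐ con c ∶ renᵗ ∅ A
    app     : ∀ {M₁ M₂ N₁ N₂ A B} →
              Σ ∣ Γ ⊢ᵒ M₁ ≐ N₁ ∶ Π A B → Σ ∣ Γ ⊢ᵒ M₂ ≐ N₂ ∶ A →
              Σ ∣ Γ ⊢ᵒ M₁ · M₂ ≐ N₁ · N₂ ∶ B [ M₂ ]ᵗ
    lam     : ∀ {A A′ A″ B M N} →
              Σ ∣ Γ ⊢ᵗ A′ ≐ A ∶ type → Σ ∣ Γ ⊢ᵗ A″ ≐ A ∶ type →
              Σ ∣ Γ ▸ A ⊢ᵒ M ≐ N ∶ B →
              Σ ∣ Γ ⊢ᵒ ƛ A′ M ≐ ƛ A″ N ∶ Π A B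
    β       : ∀ {A B M₁ M₂ N₁ N₂} →
              Σ ∣ Γ ⊢ᵗ A ∶ type → Σ ∣ Γ ▸ A ⊢ᵒ M₂ ≐ N₂ ∶ B →
              Σ ∣ Γ ⊢ᵒ M₁ ≐ N₁ ∶ A →
              Σ ∣ Γ ⊢ᵒ ƛ A M₂ · M₁ ≐ N₂ [ N₁ ] ∶ B [ M₁ ]ᵗ
    ext     : ∀ {A B M N} →
              Σ ∣ Γ ⊢ᵗ A ∶ type → Σ ∣ Γ ⊢ᵒ M ∶ Π A B → Σ ∣ Γ ⊢ᵒ N ∶ Π A B →
              Σ ∣ Γ ▸ A ⊢ᵒ wk M · var zero ≐ wk N · var zero ∶ B →
              Σ ∣ Γ ⊢ᵒ M ≐ N ∶ Π A B
    name    : ∀ {a α} → Σ ⊢ᶜ Γ → Γ ∋ⁿ a ∶ α → Σ ∣ Γ ⊢ᵒ name a ≐ name a ∶ name α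
    abs     : ∀ {α A M N} →
              Σ ∣ Γ # α ⊢ᵒ M ≐ N ∶ A → Σ ∣ Γ ⊢ᵒ ⟨ α ⟩ M ≐ ⟨ α ⟩ N ∶ New α A
    conc    : ∀ {b α Γ′ A M N} →
              Σ ⊢ᶜ Γ → Γ ⊢ b ∶ α ⧵ Γ′ → Σ ∣ Γ′ ⊢ᵒ M ≐ N ∶ New α A →
              Σ ∣ Γ ⊢ᵒ ren (thin b) M ＠ b ≐ ren (thin b) N ＠ b
                     ∶ renᵗ (liftʳ (thin b)) A [ b ]ⁿᵗ
    βⁿ      : ∀ {b α Γ′ A M N} →
              Σ ⊢ᶜ Γ → Γ ⊢ b ∶ α ⧵ Γ′ → Σ ∣ Γ′ # α ⊢ᵒ M ≐ N ∶ A →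
              Σ ∣ Γ ⊢ᵒ ren (thin b) (⟨ α ⟩ M) ＠ b
                     ≐ ren (liftʳ (thin b)) N [ b ]ⁿ
                     ∶ renᵗ (liftʳ (thin b)) A [ b ]ⁿᵗ
    extⁿ    : ∀ {α A M N} →
              Σ ∣ Γ # α ⊢ᵒ wk M ＠ zero ≐ wk N ＠ zero ∶ A →
              Σ ∣ Γ ⊢ᵒ M ≐ N ∶ New α A

data ⊢ˢ_ : Sig → Set where
  ε    : ⊢ˢ []
  con  : ∀ {Σ c A} → ⊢ˢ Σ → (∀ B → (c ∶ᵒ B) ∉ Σ) → Σ ∣ ε ⊢ᵗ A ∶ type →
         ⊢ˢ ((c ∶ᵒ A) ∷ Σ)
  tcon : ∀ {Σ a K} → ⊢ˢ Σ → (∀ L → (a ∶ᵗ L) ∉ Σ) → Σ ∣ ε ⊢ᵏ K →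
         ⊢ˢ ((a ∶ᵗ K) ∷ Σ)
  name : ∀ {Σ α} → ⊢ˢ Σ → (α ∶name) ∉ Σ → ⊢ˢ ((α ∶name) ∷ Σ)

------------------------------------------------------------------------
-- Erasure

data STy : Set where
  base : TConst → STy
  _⇒_  : STy → STy → STy
  ⟨_⟩_ : NConst → STy → STy
  name : NConst → STy

SCtx : Scope → Set
SCtx = Cx (λ _ → STy)

data _∋ˢ_∶_ : ∀ {s} → SCtx s → s ∋ vr → STy → Set where
  here   : ∀ {s} {Δ : SCtx s} {τ} → (Δ ▸ τ) ∋ˢ zero ∶ τ
  there▸ : ∀ {s} {Δ : SCtx s} {τ υ x} → Δ ∋ˢ x ∶ τ → (Δ ▸ υ) ∋ˢ suc x ∶ τ
  there# : ∀ {s} {Δ : SCtx s} {τ β x} → Δ ∋ˢ x ∶ τ → (Δ # β) ∋ˢ suc x ∶ τ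

_⁻ : ∀ {s} → Ty s → STy
con a ⁻    = base a
(A ·ᵗ M) ⁻ = A ⁻
Π A B ⁻    = A ⁻ ⇒ B ⁻
name α ⁻   = name α
New α B ⁻  = ⟨ α ⟩ (B ⁻)

_⁻ᶜ : ∀ {s} → Ctx s → SCtx s
ε ⁻ᶜ       = ε
(Γ ▸ A) ⁻ᶜ = (Γ ⁻ᶜ) ▸ (A ⁻)
(Γ # α) ⁻ᶜ = (Γ ⁻ᶜ) # α

------------------------------------------------------------------------
-- Algorithmic and structural equivalence

data _⟶_ {s} : Obj s → Obj s → Set where
  β    : ∀ {A M N} → ƛ A M · N ⟶ M [ N ]
  βⁿ   : ∀ {α M b} → (⟨ α ⟩ M) ＠ b ⟶ M [ b ]ⁿ
  app  : ∀ {M M′ N} → M ⟶ M′ → M · N ⟶ M′ · N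
  conc : ∀ {M M′ a} → M ⟶ M′ → M ＠ a ⟶ M′ ＠ a

data Atomic : STy → Set where
  base : ∀ {a} → Atomic (base a)
  name : ∀ {α} → Atomic (name α)

mutual
  data _∣_⊢_⇔_∶_ (Σ : Sig) {s} (Δ : SCtx s) : Obj s → Obj s → STy → Set where
    whˡ    : ∀ {M M′ N δ} → Atomic δ →
             M ⟶ M′ → Σ ∣ Δ ⊢ M′ ⇔ N ∶ δ → Σ ∣ Δ ⊢ M ⇔ N ∶ δ
    whʳ    : ∀ {M N N′ δ} → Atomic δ →
             N ⟶ N′ → Σ ∣ Δ ⊢ M ⇔ N′ ∶ δ → Σ ∣ Δ ⊢ M ⇔ N ∶ δ
    struct : ∀ {M N δ} → Atomic δ → Σ ∣ Δ ⊢ M ↔ N ∶ δ → Σ ∣ Δ ⊢ M ⇔ N ∶ δ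
    fun    : ∀ {M N τ₁ τ₂} →
             Σ ∣ Δ ▸ τ₁ ⊢ wk M · var zero ⇔ wk N · var zero ∶ τ₂ →
             Σ ∣ Δ ⊢ M ⇔ N ∶ (τ₁ ⇒ τ₂)
    abs    : ∀ {M N α τ} →
             Σ ∣ Δ # α ⊢ wk M ＠ zero ⇔ wk N ＠ zero ∶ τ →
             Σ ∣ Δ ⊢ M ⇔ N ∶ (⟨ α ⟩ τ)

  data _∣_⊢_↔_∶_ (Σ : Sig) {s} (Δ : SCtx s) : Obj s → Obj s → STy → Set where
    var  : ∀ {x τ} → Δ ∋ˢ x ∶ τ → Σ ∣ Δ ⊢ var x ↔ var x ∶ τ
    con  : ∀ {c A} → (c ∶ᵒ A) ∈ Σ → Σ ∣ Δ ⊢ con c ↔ con c ∶ (A ⁻)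
    name : ∀ {a α} → Δ ∋ⁿ a ∶ α → Σ ∣ Δ ⊢ name a ↔ name a ∶ name α
    app  : ∀ {M₁ M₂ N₁ N₂ τ₁ τ₂} →
           Σ ∣ Δ ⊢ M₁ ↔ N₁ ∶ (τ₁ ⇒ τ₂) → Σ ∣ Δ ⊢ M₂ ⇔ N₂ ∶ τ₁ →
           Σ ∣ Δ ⊢ M₁ · M₂ ↔ N₁ · N₂ ∶ τ₂
    conc : ∀ {a α Δ′ M N τ} →
           Δ ⊢ a ∶ α ⧵ Δ′ → Σ ∣ Δ′ ⊢ M ↔ N ∶ (⟨ α ⟩ τ) →
           Σ ∣ Δ ⊢ ren (thin a) M ＠ a ↔ ren (thin a) N ＠ a ∶ τ

-- A Kripke logical relation over simple types, whose worlds are simple contexts,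
-- contains definitional equality and is contained in algorithmic equivalence.  A
-- substitution into a world Δ sends a name to some b such that everything declared
-- before that name already lives in the restriction of Δ at b; this is what makes
-- the rules for concretion go through, and it is stable under weakening because
-- restrictions at two distinct names commute.  Transitivity is built into the
-- relation by showing that algorithmic equivalence is transitive, which needs
-- determinacy of weak head reduction and unique types of neutral objects.

module Submission where

open import Data.Empty using (⊥-elim)
open import Data.List using ([]; _∷_)
open import Data.List.Membership.Propositional using (_∈_)
open import Data.List.Relation.Unary.Any using (here; there)
open import Data.Product using (Σ-syntax; _×_; _,_)
open import Relation.Binary.PropositionalEquality
  using (_≡_; refl; sym; trans; cong; cong₂; subst; subst₂)
open import Relation.Nullary using (¬_)

open import Defs

-- Renaming and substitution

-- Renamings and substitutions are functions, so the laws below assume pointwise equations between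
-- them. Such equations lift under binders, and function extensionality is avoided.
liftʳ-id : ∀ {s l} {ρ : Ren s s} → (∀ {k} (i : s ∋ k) → ρ i ≡ i) →
           ∀ {k} (i : (l ∷ s) ∋ k) → liftʳ ρ i ≡ i
liftʳ-id e zero    = refl
liftʳ-id e (suc i) = cong suc (e i)

mutual
  renᵗ-id : ∀ {s} {ρ : Ren s s} → (∀ {k} (i : s ∋ k) → ρ i ≡ i) →
            ∀ A → renᵗ ρ A ≡ A
  renᵗ-id e (con a)   = refl
  renᵗ-id e (A ·ᵗ M)  = cong₂ _·ᵗ_ (renᵗ-id e A) (ren-id e M)
  renᵗ-id e (Π A B)   = cong₂ Π (renᵗ-id e A) (renᵗ-id (liftʳ-id e) B)
  renᵗ-id e (name α)  = refl
  renᵗ-id e (New α B) = cong (New α) (renᵗ-id (liftʳ-id e) B)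

  ren-id : ∀ {s} {ρ : Ren s s} → (∀ {k} (i : s ∋ k) → ρ i ≡ i) →
           ∀ M → ren ρ M ≡ M
  ren-id e (con c)   = refl
  ren-id e (var x)   = cong var (e x)
  ren-id e (ƛ A M)   = cong₂ ƛ (renᵗ-id e A) (ren-id (liftʳ-id e) M)
  ren-id e (M · N)   = cong₂ _·_ (ren-id e M) (ren-id e N)
  ren-id e (name a)  = cong name (e a)
  ren-id e (⟨ α ⟩ M) = cong (⟨ α ⟩_) (ren-id (liftʳ-id e) M)
  ren-id e (M ＠ a)  = cong₂ _＠_ (ren-id e M) (e a)

liftʳ-ren : ∀ {s t u l} {ρ : Ren s t} {ρ′ : Ren t u} {ρ″ : Ren s u} →
            (∀ {k} (i : s ∋ k) → ρ′ (ρ i) ≡ ρ″ i) →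
            ∀ {k} (i : (l ∷ s) ∋ k) → liftʳ ρ′ (liftʳ ρ i) ≡ liftʳ ρ″ i
liftʳ-ren e zero    = refl
liftʳ-ren e (suc i) = cong suc (e i)

mutual
  renᵗ-ren : ∀ {s t u} {ρ : Ren s t} {ρ′ : Ren t u} {ρ″ : Ren s u} →
             (∀ {k} (i : s ∋ k) → ρ′ (ρ i) ≡ ρ″ i) →
             ∀ A → renᵗ ρ′ (renᵗ ρ A) ≡ renᵗ ρ″ A
  renᵗ-ren e (con a)   = refl
  renᵗ-ren e (A ·ᵗ M)  = cong₂ _·ᵗ_ (renᵗ-ren e A) (ren-ren e M)
  renᵗ-ren e (Π A B)   = cong₂ Π (renᵗ-ren e A) (renᵗ-ren (liftʳ-ren e) B)
  renᵗ-ren e (name α)  = refl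
  renᵗ-ren e (New α B) = cong (New α) (renᵗ-ren (liftʳ-ren e) B)

  ren-ren : ∀ {s t u} {ρ : Ren s t} {ρ′ : Ren t u} {ρ″ : Ren s u} →
            (∀ {k} (i : s ∋ k) → ρ′ (ρ i) ≡ ρ″ i) →
            ∀ M → ren ρ′ (ren ρ M) ≡ ren ρ″ M
  ren-ren e (con c)   = refl
  ren-ren e (var x)   = cong var (e x)
  ren-ren e (ƛ A M)   = cong₂ ƛ (renᵗ-ren e A) (ren-ren (liftʳ-ren e) M)
  ren-ren e (M · N)   = cong₂ _·_ (ren-ren e M) (ren-ren e N)
  ren-ren e (name a)  = cong name (e a)
  ren-ren e (⟨ α ⟩ M) = cong (⟨ α ⟩_) (ren-ren (liftʳ-ren e) M)
  ren-ren e (M ＠ a)  = cong₂ _＠_ (ren-ren e M) (e a)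

ren-square : ∀ {s t t′ u} {ρ : Ren s t} {ρ′ : Ren t u} {φ : Ren s t′} {φ′ : Ren t′ u} →
             (∀ {k} (i : s ∋ k) → ρ′ (ρ i) ≡ φ′ (φ i)) →
             ∀ M → ren ρ′ (ren ρ M) ≡ ren φ′ (ren φ M)
ren-square e M = trans (ren-ren e M) (sym (ren-ren (λ _ → refl) M))

wk-ren : ∀ {s t l} {ρ : Ren s t} (M : Obj s) →
         ren (liftʳ {l = l} ρ) (wk M) ≡ wk (ren ρ M)
wk-ren = ren-square (λ _ → refl)

renImg : ∀ k {s t} → Ren s t → Img k s → Img k t
renImg vr ρ M = ren ρ M
renImg nm ρ a = ρ a

renImg-square : ∀ k {s t t′ u} {ρ : Ren s t} {ρ′ : Ren t u} {φ : Ren s t′} {φ′ : Ren t′ u} →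
                (∀ {k} (i : s ∋ k) → ρ′ (ρ i) ≡ φ′ (φ i)) →
                ∀ x → renImg k ρ′ (renImg k ρ x) ≡ renImg k φ′ (renImg k φ x)
renImg-square vr e M = ren-square e M
renImg-square nm e a = e a

subImg : ∀ k {s t} → Sub s t → Img k s → Img k t
subImg vr σ M = sub σ M
subImg nm σ a = σ a

liftˢ-ren : ∀ {s t u l} {ρ : Ren s t} {σ : Sub t u} {θ : Sub s u} →
            (∀ {k} (i : s ∋ k) → σ (ρ i) ≡ θ i) →
            ∀ {k} (i : (l ∷ s) ∋ k) → liftˢ σ (liftʳ ρ i) ≡ liftˢ θ i
liftˢ-ren e     zero    = refl
liftˢ-ren e {k} (suc i) = cong (wkImg k) (e i)

mutual
  subᵗ-ren : ∀ {s t u} {ρ : Ren s t} {σ : Sub t u} {θ : Sub s u} →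
             (∀ {k} (i : s ∋ k) → σ (ρ i) ≡ θ i) →
             ∀ A → subᵗ σ (renᵗ ρ A) ≡ subᵗ θ A
  subᵗ-ren e (con a)   = refl
  subᵗ-ren e (A ·ᵗ M)  = cong₂ _·ᵗ_ (subᵗ-ren e A) (sub-ren e M)
  subᵗ-ren e (Π A B)   = cong₂ Π (subᵗ-ren e A) (subᵗ-ren (liftˢ-ren e) B)
  subᵗ-ren e (name α)  = refl
  subᵗ-ren e (New α B) = cong (New α) (subᵗ-ren (liftˢ-ren e) B)

  sub-ren : ∀ {s t u} {ρ : Ren s t} {σ : Sub t u} {θ : Sub s u} →
            (∀ {k} (i : s ∋ k) → σ (ρ i) ≡ θ i) →
            ∀ M → sub σ (ren ρ M) ≡ sub θ M
  sub-ren e (con c)   = refl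
  sub-ren e (var x)   = e x
  sub-ren e (ƛ A M)   = cong₂ ƛ (subᵗ-ren e A) (sub-ren (liftˢ-ren e) M)
  sub-ren e (M · N)   = cong₂ _·_ (sub-ren e M) (sub-ren e N)
  sub-ren e (name a)  = cong name (e a)
  sub-ren e (⟨ α ⟩ M) = cong (⟨ α ⟩_) (sub-ren (liftˢ-ren e) M)
  sub-ren e (M ＠ a)  = cong₂ _＠_ (sub-ren e M) (e a)

renImg-liftˢ : ∀ {s t u l} {σ : Sub s t} {ρ : Ren t u} {θ : Sub s u} →
               (∀ {k} (i : s ∋ k) → renImg k ρ (σ i) ≡ θ i) →
               ∀ {k} (i : (l ∷ s) ∋ k) → renImg k (liftʳ ρ) (liftˢ σ i) ≡ liftˢ θ i
renImg-liftˢ         e {vr} zero    = refl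
renImg-liftˢ         e {nm} zero    = refl
renImg-liftˢ {σ = σ} e {vr} (suc i) = trans (wk-ren (σ i)) (cong wk (e i))
renImg-liftˢ         e {nm} (suc i) = cong suc (e i)

mutual
  renᵗ-sub : ∀ {s t u} {σ : Sub s t} {ρ : Ren t u} {θ : Sub s u} →
             (∀ {k} (i : s ∋ k) → renImg k ρ (σ i) ≡ θ i) →
             ∀ A → renᵗ ρ (subᵗ σ A) ≡ subᵗ θ A
  renᵗ-sub e (con a)   = refl
  renᵗ-sub e (A ·ᵗ M)  = cong₂ _·ᵗ_ (renᵗ-sub e A) (ren-sub e M)
  renᵗ-sub e (Π A B)   = cong₂ Π (renᵗ-sub e A) (renᵗ-sub (renImg-liftˢ e) B)
  renᵗ-sub e (name α)  = refl
  renᵗ-sub e (New α B) = cong (New α) (renᵗ-sub (renImg-liftˢ e) B)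

  ren-sub : ∀ {s t u} {σ : Sub s t} {ρ : Ren t u} {θ : Sub s u} →
            (∀ {k} (i : s ∋ k) → renImg k ρ (σ i) ≡ θ i) →
            ∀ M → ren ρ (sub σ M) ≡ sub θ M
  ren-sub e (con c)   = refl
  ren-sub e (var x)   = e x
  ren-sub e (ƛ A M)   = cong₂ ƛ (renᵗ-sub e A) (ren-sub (renImg-liftˢ e) M)
  ren-sub e (M · N)   = cong₂ _·_ (ren-sub e M) (ren-sub e N)
  ren-sub e (name a)  = cong name (e a)
  ren-sub e (⟨ α ⟩ M) = cong (⟨ α ⟩_) (ren-sub (renImg-liftˢ e) M)
  ren-sub e (M ＠ a)  = cong₂ _＠_ (ren-sub e M) (e a)

subImg-liftˢ : ∀ {s t u l} {σ : Sub s t} {σ′ : Sub t u} {θ : Sub s u} →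
               (∀ {k} (i : s ∋ k) → subImg k σ′ (σ i) ≡ θ i) →
               ∀ {k} (i : (l ∷ s) ∋ k) → subImg k (liftˢ σ′) (liftˢ σ i) ≡ liftˢ θ i
subImg-liftˢ         e {vr} zero    = refl
subImg-liftˢ         e {nm} zero    = refl
subImg-liftˢ {σ = σ} {σ′} e {vr} (suc i) =
  -- Substitution commutes with weakening: both orders equal the single substitution with weakened
  -- images. The match on the sort makes `renImg k suc` and `wkImg k` agree by computation.
  trans (sub-ren (λ _ → refl) (σ i))
        (trans (sym (ren-sub (λ { {vr} _ → refl ; {nm} _ → refl }) (σ i))) (cong wk (e i)))
subImg-liftˢ         e {nm} (suc i) = cong suc (e i)

mutual
  subᵗ-sub : ∀ {s t u} {σ : Sub s t} {σ′ : Sub t u} {θ : Sub s u} →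
             (∀ {k} (i : s ∋ k) → subImg k σ′ (σ i) ≡ θ i) →
             ∀ A → subᵗ σ′ (subᵗ σ A) ≡ subᵗ θ A
  subᵗ-sub e (con a)   = refl
  subᵗ-sub e (A ·ᵗ M)  = cong₂ _·ᵗ_ (subᵗ-sub e A) (sub-sub e M)
  subᵗ-sub e (Π A B)   = cong₂ Π (subᵗ-sub e A) (subᵗ-sub (subImg-liftˢ e) B)
  subᵗ-sub e (name α)  = refl
  subᵗ-sub e (New α B) = cong (New α) (subᵗ-sub (subImg-liftˢ e) B)

  sub-sub : ∀ {s t u} {σ : Sub s t} {σ′ : Sub t u} {θ : Sub s u} →
            (∀ {k} (i : s ∋ k) → subImg k σ′ (σ i) ≡ θ i) →
            ∀ M → sub σ′ (sub σ M) ≡ sub θ M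
  sub-sub e (con c)   = refl
  sub-sub e (var x)   = e x
  sub-sub e (ƛ A M)   = cong₂ ƛ (subᵗ-sub e A) (sub-sub (subImg-liftˢ e) M)
  sub-sub e (M · N)   = cong₂ _·_ (sub-sub e M) (sub-sub e N)
  sub-sub e (name a)  = cong name (e a)
  sub-sub e (⟨ α ⟩ M) = cong (⟨ α ⟩_) (sub-sub (subImg-liftˢ e) M)
  sub-sub e (M ＠ a)  = cong₂ _＠_ (sub-sub e M) (e a)

liftˢ-id : ∀ {s l} {σ : Sub s s} → (∀ {k} (i : s ∋ k) → σ i ≡ fromIndex k i) →
           ∀ {k} (i : (l ∷ s) ∋ k) → liftˢ σ i ≡ fromIndex k i
liftˢ-id e      zero    = refl
liftˢ-id e {vr} (suc i) = cong wk (e i)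
liftˢ-id e {nm} (suc i) = cong suc (e i)

mutual
  subᵗ-id : ∀ {s} {σ : Sub s s} → (∀ {k} (i : s ∋ k) → σ i ≡ fromIndex k i) →
            ∀ A → subᵗ σ A ≡ A
  subᵗ-id e (con a)   = refl
  subᵗ-id e (A ·ᵗ M)  = cong₂ _·ᵗ_ (subᵗ-id e A) (sub-id e M)
  subᵗ-id e (Π A B)   = cong₂ Π (subᵗ-id e A) (subᵗ-id (liftˢ-id e) B)
  subᵗ-id e (name α)  = refl
  subᵗ-id e (New α B) = cong (New α) (subᵗ-id (liftˢ-id e) B)

  sub-id : ∀ {s} {σ : Sub s s} → (∀ {k} (i : s ∋ k) → σ i ≡ fromIndex k i) →
           ∀ M → sub σ M ≡ M
  sub-id e (con c)   = refl
  sub-id e (var x)   = e x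
  sub-id e (ƛ A M)   = cong₂ ƛ (subᵗ-id e A) (sub-id (liftˢ-id e) M)
  sub-id e (M · N)   = cong₂ _·_ (sub-id e M) (sub-id e N)
  sub-id e (name a)  = cong name (e a)
  sub-id e (⟨ α ⟩ M) = cong (⟨ α ⟩_) (sub-id (liftˢ-id e) M)
  sub-id e (M ＠ a)  = cong₂ _＠_ (sub-id e M) (e a)

extˢ : ∀ {s t l} → Img l t → Sub s t → Sub (l ∷ s) t
extˢ x σ zero    = x
extˢ x σ (suc i) = σ i

renSub : ∀ {s t u} → Ren t u → Sub s t → Sub s u
renSub ρ σ {k} i = renImg k ρ (σ i)

inst-wk : ∀ k {s} {N : Obj s} (x : Img k s) → subImg k (inst N) (wkImg k x) ≡ x
inst-wk vr M = trans (sub-ren (λ _ → refl) M) (sub-id (λ _ → refl) M)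
inst-wk nm a = refl

-- Together with `sub-inst`, this brings both sides of a β-step under a substitution to the form
-- `extˢ`, a single simultaneous substitution of the kind that an extended environment relates.
liftˢ-inst : ∀ {s t} {σ : Sub s t} {N : Obj t} (M : Obj (vr ∷ s)) →
             sub (liftˢ σ) M [ N ] ≡ sub (extˢ N σ) M
liftˢ-inst {σ = σ} {N} = sub-sub {θ = extˢ N σ} λ where
  zero        → refl
  {k} (suc i) → inst-wk k (σ i)

liftˢ-instⁿ : ∀ {s t} {σ : Sub s t} {b : t ∋ nm} (M : Obj (nm ∷ s)) →
              sub (liftˢ σ) M [ b ]ⁿ ≡ sub (extˢ b σ) M
liftˢ-instⁿ {σ = σ} {b} = ren-sub {θ = extˢ b σ} λ where
  zero         → refl
  {vr} (suc i) → trans (ren-ren (λ _ → refl) (σ i)) (ren-id (λ _ → refl) (σ i))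
  {nm} (suc i) → refl

sub-inst : ∀ {s t} {σ : Sub s t} {N : Obj s} (M : Obj (vr ∷ s)) →
           sub σ (M [ N ]) ≡ sub (extˢ (sub σ N) σ) M
sub-inst {σ = σ} {N} = sub-sub {θ = extˢ (sub σ N) σ} λ where
  zero         → refl
  {vr} (suc i) → refl
  {nm} (suc i) → refl

ren-inst : ∀ {s t} {ρ : Ren s t} {N : Obj s} (M : Obj (vr ∷ s)) →
           ren ρ (M [ N ]) ≡ ren (liftʳ ρ) M [ ren ρ N ]
ren-inst {ρ = ρ} {N} M =
  trans (ren-sub {θ = renSub ρ (inst N)} (λ _ → refl) M)
        (sym (sub-ren (λ where
          zero         → refl
          {vr} (suc i) → refl
          {nm} (suc i) → refl) M))

ren-instⁿ : ∀ {s t} {ρ : Ren s t} {b : s ∋ nm} (M : Obj (nm ∷ s)) →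
            ren ρ (M [ b ]ⁿ) ≡ ren (liftʳ ρ) M [ ρ b ]ⁿ
ren-instⁿ = ren-square λ where
  zero    → refl
  (suc i) → refl

-- Injectivity of renaming

Injective : ∀ {s t} → Ren s t → Set
Injective {s} ρ = ∀ {k} {i j : s ∋ k} → ρ i ≡ ρ j → i ≡ j

suc-injective : ∀ {s k l} {i j : s ∋ k} → suc {l = l} i ≡ suc j → i ≡ j
suc-injective refl = refl

liftʳ-injective : ∀ {s t l} {ρ : Ren s t} → Injective ρ → Injective (liftʳ {l = l} ρ)
liftʳ-injective inj {i = zero}  {j = zero}  e = refl
liftʳ-injective inj {i = suc i} {j = suc j} e = cong suc (inj (suc-injective e))
liftʳ-injective inj {i = zero}  {j = suc j} ()
liftʳ-injective inj {i = suc i} {j = zero}  ()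

thin-injective : ∀ {s} (a : s ∋ nm) → Injective (thin a)
thin-injective          zero    e = suc-injective e
thin-injective {vr ∷ _} (suc a) e = thin-injective a (suc-injective e)
thin-injective {nm ∷ _} (suc a) {i = zero}  {j = zero}  e = refl
thin-injective {nm ∷ _} (suc a) {i = suc i} {j = suc j} e =
  cong suc (thin-injective a (suc-injective e))
thin-injective {nm ∷ _} (suc a) {i = zero}  {j = suc j} ()
thin-injective {nm ∷ _} (suc a) {i = suc i} {j = zero}  ()

-- The graph of renaming, so that two preimages of one expression can be
-- compared by matching on the expression.

infix 5 _⊢_↦ᵗ_ _⊢_↦_

mutual
  data _⊢_↦ᵗ_ {s t} (ρ : Ren s t) : Ty s → Ty t → Set where
    con  : ∀ {a} → ρ ⊢ con a ↦ᵗ con a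
    _·ᵗ_ : ∀ {A A′ M M′} → ρ ⊢ A ↦ᵗ A′ → ρ ⊢ M ↦ M′ → ρ ⊢ A ·ᵗ M ↦ᵗ A′ ·ᵗ M′
    Π    : ∀ {A A′ B B′} → ρ ⊢ A ↦ᵗ A′ → liftʳ ρ ⊢ B ↦ᵗ B′ → ρ ⊢ Π A B ↦ᵗ Π A′ B′
    name : ∀ {α} → ρ ⊢ name α ↦ᵗ name α
    New  : ∀ {α B B′} → liftʳ ρ ⊢ B ↦ᵗ B′ → ρ ⊢ New α B ↦ᵗ New α B′

  data _⊢_↦_ {s t} (ρ : Ren s t) : Obj s → Obj t → Set where
    con  : ∀ {c} → ρ ⊢ con c ↦ con c
    var  : ∀ {x y} → ρ x ≡ y → ρ ⊢ var x ↦ var y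
    ƛ    : ∀ {A A′ M M′} → ρ ⊢ A ↦ᵗ A′ → liftʳ ρ ⊢ M ↦ M′ → ρ ⊢ ƛ A M ↦ ƛ A′ M′
    _·_  : ∀ {M M′ N N′} → ρ ⊢ M ↦ M′ → ρ ⊢ N ↦ N′ → ρ ⊢ M · N ↦ M′ · N′
    name : ∀ {a b} → ρ a ≡ b → ρ ⊢ name a ↦ name b
    abs  : ∀ {α M M′} → liftʳ ρ ⊢ M ↦ M′ → ρ ⊢ ⟨ α ⟩ M ↦ ⟨ α ⟩ M′
    _＠_ : ∀ {M M′ a b} → ρ ⊢ M ↦ M′ → ρ a ≡ b → ρ ⊢ M ＠ a ↦ M′ ＠ b

mutual
  graphᵗ : ∀ {s t} (ρ : Ren s t) A → ρ ⊢ A ↦ᵗ renᵗ ρ A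
  graphᵗ ρ (con a)   = con
  graphᵗ ρ (A ·ᵗ M)  = graphᵗ ρ A ·ᵗ graph ρ M
  graphᵗ ρ (Π A B)   = Π (graphᵗ ρ A) (graphᵗ (liftʳ ρ) B)
  graphᵗ ρ (name α)  = name
  graphᵗ ρ (New α B) = New (graphᵗ (liftʳ ρ) B)

  graph : ∀ {s t} (ρ : Ren s t) M → ρ ⊢ M ↦ ren ρ M
  graph ρ (con c)   = con
  graph ρ (var x)   = var refl
  graph ρ (ƛ A M)   = ƛ (graphᵗ ρ A) (graph (liftʳ ρ) M)
  graph ρ (M · N)   = graph ρ M · graph ρ N
  graph ρ (name a)  = name refl
  graph ρ (⟨ α ⟩ M) = abs (graph (liftʳ ρ) M)
  graph ρ (M ＠ a)  = graph ρ M ＠ refl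

mutual
  graphᵗ-injective : ∀ {s t} {ρ : Ren s t} → Injective ρ →
                     ∀ {A B C} → ρ ⊢ A ↦ᵗ C → ρ ⊢ B ↦ᵗ C → A ≡ B
  graphᵗ-injective inj con      con        = refl
  graphᵗ-injective inj (g ·ᵗ h) (g′ ·ᵗ h′) =
    cong₂ _·ᵗ_ (graphᵗ-injective inj g g′) (graph-injective inj h h′)
  graphᵗ-injective inj (Π g h)  (Π g′ h′)  =
    cong₂ Π (graphᵗ-injective inj g g′) (graphᵗ-injective (liftʳ-injective inj) h h′)
  graphᵗ-injective inj name     name       = refl
  graphᵗ-injective inj (New g)  (New g′)   =
    cong (New _) (graphᵗ-injective (liftʳ-injective inj) g g′)

  graph-injective : ∀ {s t} {ρ : Ren s t} → Injective ρ →
                    ∀ {M N P} → ρ ⊢ M ↦ P → ρ ⊢ N ↦ P → M ≡ N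
  graph-injective inj con      con        = refl
  graph-injective inj (var e)  (var e′)   = cong var (inj (trans e (sym e′)))
  graph-injective inj (ƛ g h)  (ƛ g′ h′)  =
    cong₂ ƛ (graphᵗ-injective inj g g′) (graph-injective (liftʳ-injective inj) h h′)
  graph-injective inj (g · h)  (g′ · h′)  =
    cong₂ _·_ (graph-injective inj g g′) (graph-injective inj h h′)
  graph-injective inj (name e) (name e′)  = cong name (inj (trans e (sym e′)))
  graph-injective inj (abs g)  (abs g′)   =
    cong (⟨ _ ⟩_) (graph-injective (liftʳ-injective inj) g g′)
  graph-injective inj (g ＠ e) (g′ ＠ e′) =
    cong₂ _＠_ (graph-injective inj g g′) (inj (trans e (sym e′)))

-- Applied to `thin a`: in the transitivity of structural equivalence at a concretion, the middle
-- object must determine its preimage over the restricted scope.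
ren-injective : ∀ {s t} {ρ : Ren s t} → Injective ρ → ∀ {M N} → ren ρ M ≡ ren ρ N → M ≡ N
ren-injective {ρ = ρ} inj {M} {N} e =
  graph-injective inj (graph ρ M) (subst (ρ ⊢ N ↦_) (sym e) (graph ρ N))

-- Erasure

⁻-ren : ∀ {s t} (ρ : Ren s t) A → renᵗ ρ A ⁻ ≡ A ⁻
⁻-ren ρ (con a)   = refl
⁻-ren ρ (A ·ᵗ M)  = ⁻-ren ρ A
⁻-ren ρ (Π A B)   = cong₂ _⇒_ (⁻-ren ρ A) (⁻-ren (liftʳ ρ) B)
⁻-ren ρ (name α)  = refl
⁻-ren ρ (New α B) = cong (⟨ α ⟩_) (⁻-ren (liftʳ ρ) B)

⁻-sub : ∀ {s t} (σ : Sub s t) A → subᵗ σ A ⁻ ≡ A ⁻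
⁻-sub σ (con a)   = refl
⁻-sub σ (A ·ᵗ M)  = ⁻-sub σ A
⁻-sub σ (Π A B)   = cong₂ _⇒_ (⁻-sub σ A) (⁻-sub (liftˢ σ) B)
⁻-sub σ (name α)  = refl
⁻-sub σ (New α B) = cong (⟨ α ⟩_) (⁻-sub (liftˢ σ) B)

-- Equal families differ only inside object arguments, which erasure drops. The conversion rule
-- thereby becomes transport along an equation of simple types.
⁻-≐ : ∀ {Σ s} {Γ : Ctx s} {A B K} → Σ ∣ Γ ⊢ᵗ A ≐ B ∶ K → A ⁻ ≡ B ⁻
⁻-≐ (≐-sym d)     = sym (⁻-≐ d)
⁻-≐ (≐-trans d e) = trans (⁻-≐ d) (⁻-≐ e)
⁻-≐ (conv d _)    = ⁻-≐ d
⁻-≐ (con _ _)     = refl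
⁻-≐ (app d _)     = ⁻-≐ d
⁻-≐ (Π _ d e)     = cong₂ _⇒_ (⁻-≐ d) (⁻-≐ e)
⁻-≐ (ext {A₁} {A₂} d) = trans (sym (⁻-ren suc A₁)) (trans (⁻-≐ d) (⁻-ren suc A₂))
⁻-≐ (name _ _)    = refl
⁻-≐ (New d)       = cong (⟨ _ ⟩_) (⁻-≐ d)

⁻-∋ : ∀ {s} {Γ : Ctx s} {x A} → Γ ∋ᵛ x ∶ A → (Γ ⁻ᶜ) ∋ˢ x ∶ (A ⁻)
⁻-∋ (here {Γ = Γ} {A})         = subst (((Γ ▸ A) ⁻ᶜ) ∋ˢ zero ∶_) (sym (⁻-ren suc A)) here
⁻-∋ (there▸ {A = A} {x = x} p) = subst (_ ∋ˢ suc x ∶_) (sym (⁻-ren suc A)) (there▸ (⁻-∋ p))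
⁻-∋ (there# {A = A} {x = x} p) = subst (_ ∋ˢ suc x ∶_) (sym (⁻-ren suc A)) (there# (⁻-∋ p))

⁻-∋ⁿ : ∀ {s} {Γ : Ctx s} {a α} → Γ ∋ⁿ a ∶ α → (Γ ⁻ᶜ) ∋ⁿ a ∶ α
⁻-∋ⁿ here       = here
⁻-∋ⁿ (there▸ p) = there▸ (⁻-∋ⁿ p)
⁻-∋ⁿ (there# p) = there# (⁻-∋ⁿ p)

⁻-⧵ : ∀ {s} {Γ : Ctx s} {a α Γ′} → Γ ⊢ a ∶ α ⧵ Γ′ → (Γ ⁻ᶜ) ⊢ a ∶ α ⧵ (Γ′ ⁻ᶜ)
⁻-⧵ here       = here
⁻-⧵ (there# r) = there# (⁻-⧵ r)
⁻-⧵ (there▸ r) = there▸ (⁻-⧵ r)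

-- Restriction and weakening of simple contexts

-- The restriction judgment with an unconstrained scope for the smaller context,
-- so that iterated restrictions can be compared without transport.
data _⊢_∶_↘_ : ∀ {s t} → SCtx s → s ∋ nm → NConst → SCtx t → Set where
  here   : ∀ {s} {Δ : SCtx s} {α} → (Δ # α) ⊢ zero ∶ α ↘ Δ
  there# : ∀ {s t} {Δ : SCtx s} {a α} {Δ′ : SCtx t} {β} →
           Δ ⊢ a ∶ α ↘ Δ′ → (Δ # β) ⊢ suc a ∶ α ↘ (Δ′ # β)
  there▸ : ∀ {s t} {Δ : SCtx s} {a α} {Δ′ : SCtx t} {τ} →
           Δ ⊢ a ∶ α ↘ Δ′ → (Δ ▸ τ) ⊢ suc a ∶ α ↘ Δ′

-- The counterpart of `thin`. It recurses on the derivation because the smaller scope is no longer a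
-- function of the name.
incl : ∀ {s t} {Δ : SCtx s} {a α} {Δ′ : SCtx t} → Δ ⊢ a ∶ α ↘ Δ′ → Ren t s
incl here       i       = suc i
incl (there# r) zero    = zero
incl (there# r) (suc i) = suc (incl r i)
incl (there▸ r) i       = suc (incl r i)

⧵⇒↘ : ∀ {s} {Δ : SCtx s} {a α Δ′} → Δ ⊢ a ∶ α ⧵ Δ′ → Δ ⊢ a ∶ α ↘ Δ′
⧵⇒↘ here       = here
⧵⇒↘ (there# r) = there# (⧵⇒↘ r)
⧵⇒↘ (there▸ r) = there▸ (⧵⇒↘ r)

incl-thin : ∀ {s} {Δ : SCtx s} {a α Δ′} (r : Δ ⊢ a ∶ α ⧵ Δ′) →
            ∀ {k} (i : (s ∖ a) ∋ k) → incl (⧵⇒↘ r) i ≡ thin a i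
incl-thin here       i       = refl
incl-thin (there# r) zero    = refl
incl-thin (there# r) (suc i) = cong suc (incl-thin r i)
incl-thin (there▸ r) i       = cong suc (incl-thin r i)

-- A view: matching on `from⧵` refines the free scope to `s ∖ a` and the derivation to one in the
-- image of `⧵⇒↘` at the same time.
data From⧵ {s} {Δ : SCtx s} {a α} : ∀ {t} {Δ′ : SCtx t} → Δ ⊢ a ∶ α ↘ Δ′ → Set where
  from⧵ : ∀ {Δ′} (r : Δ ⊢ a ∶ α ⧵ Δ′) → From⧵ (⧵⇒↘ r)

↘⇒⧵ : ∀ {s t} {Δ : SCtx s} {a α} {Δ′ : SCtx t} (r : Δ ⊢ a ∶ α ↘ Δ′) → From⧵ r
↘⇒⧵ here = from⧵ here
↘⇒⧵ (there# r) with ↘⇒⧵ r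
... | from⧵ r′ = from⧵ (there# r′)
↘⇒⧵ (there▸ r) with ↘⇒⧵ r
... | from⧵ r′ = from⧵ (there▸ r′)

↘⇒∋ : ∀ {s t} {Δ : SCtx s} {a α} {Δ′ : SCtx t} → Δ ⊢ a ∶ α ↘ Δ′ → Δ ∋ⁿ a ∶ α
↘⇒∋ here       = here
↘⇒∋ (there# r) = there# (↘⇒∋ r)
↘⇒∋ (there▸ r) = there▸ (↘⇒∋ r)

∋⇒↘ : ∀ {s} {Δ : SCtx s} {a α} → Δ ∋ⁿ a ∶ α →
      Σ[ t ∈ Scope ] Σ[ Δ′ ∈ SCtx t ] (Δ ⊢ a ∶ α ↘ Δ′)
∋⇒↘ here = _ , _ , here
∋⇒↘ (there▸ p) with ∋⇒↘ p
... | _ , _ , r = _ , _ , there▸ r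
∋⇒↘ (there# p) with ∋⇒↘ p
... | _ , _ , r = _ , _ , there# r

incl-∋ : ∀ {s t} {Δ : SCtx s} {a α} {Δ′ : SCtx t} (r : Δ ⊢ a ∶ α ↘ Δ′) →
         ∀ {x τ} → Δ′ ∋ˢ x ∶ τ → Δ ∋ˢ incl r x ∶ τ
incl-∋ here       p          = there# p
incl-∋ (there# r) (there# p) = there# (incl-∋ r p)
incl-∋ (there▸ r) p          = there▸ (incl-∋ r p)

record Swap {s t u} {Δ : SCtx s} {b β} {Δ₁ : SCtx t} {a α} {Δ₂ : SCtx u}
            (r : Δ ⊢ b ∶ β ↘ Δ₁) (q : Δ₁ ⊢ a ∶ α ↘ Δ₂) : Set where
  constructor swapped
  field
    {scope} : Scope
    {ctx}   : SCtx scope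
    {b′}    : scope ∋ nm
    outer   : Δ ⊢ incl r a ∶ α ↘ ctx
    inner   : ctx ⊢ b′ ∶ β ↘ Δ₂
    fixes   : incl outer b′ ≡ b
    square  : ∀ {k} (i : u ∋ k) → incl r (incl q i) ≡ incl outer (incl inner i)

-- The two names differ, since `a` survives restriction at `b`. Either order of restriction removes
-- both names and all variables declared after the earlier one, so the same context remains.
swap : ∀ {s t u} {Δ : SCtx s} {b β} {Δ₁ : SCtx t} {a α} {Δ₂ : SCtx u}
       (r : Δ ⊢ b ∶ β ↘ Δ₁) (q : Δ₁ ⊢ a ∶ α ↘ Δ₂) → Swap r q
swap here       q    = swapped (there# q) here refl λ _ → refl
swap (there# r) here = swapped here r refl λ _ → refl
swap (there# r) (there# q) with swap r q
... | swapped r′ q′ e f = swapped (there# r′) (there# q′) (cong suc e) λ where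
  zero    → refl
  (suc i) → cong suc (f i)
swap (there▸ r) q with swap r q
... | swapped r′ q′ e f = swapped (there▸ r′) q′ (cong suc e) λ i → cong suc (f i)

-- A weakening may also reorder names and identify variables: substituting b for
-- the last name of Δ′ # α, where Δ restricts to Δ′ at b, is a weakening into Δ.
data Wk : ∀ {s t} → SCtx s → SCtx t → Ren s t → Set where
  ε     : ∀ {t} {Δ′ : SCtx t} {ρ : Ren [] t} → Wk ε Δ′ ρ
  _▸_   : ∀ {s t} {Δ : SCtx s} {Δ′ : SCtx t} {τ} {ρ : Ren (vr ∷ s) t} →
          Wk Δ Δ′ (λ i → ρ (suc i)) → Δ′ ∋ˢ ρ zero ∶ τ → Wk (Δ ▸ τ) Δ′ ρ
  fresh : ∀ {s t u} {Δ : SCtx s} {Δ′ : SCtx t} {Δ″ : SCtx u} {α b}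
          {ρ : Ren (nm ∷ s) t} {ρ′ : Ren s u} →
          (r : Δ′ ⊢ b ∶ α ↘ Δ″) → ρ zero ≡ b →
          (∀ {k} (i : s ∋ k) → ρ (suc i) ≡ incl r (ρ′ i)) →
          Wk Δ Δ″ ρ′ → Wk (Δ # α) Δ′ ρ

wk-▸ : ∀ {s t} {Δ : SCtx s} {Δ′ : SCtx t} {τ} {ρ : Ren s t} →
       Wk Δ Δ′ ρ → Wk Δ (Δ′ ▸ τ) (λ i → suc (ρ i))
wk-▸ ε               = ε
wk-▸ (w ▸ p)         = wk-▸ w ▸ there▸ p
wk-▸ (fresh r e f w) = fresh (there▸ r) (cong suc e) (λ i → cong suc (f i)) w

wk-# : ∀ {s t} {Δ : SCtx s} {Δ′ : SCtx t} {β} {ρ : Ren s t} →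
       Wk Δ Δ′ ρ → Wk Δ (Δ′ # β) (λ i → suc (ρ i))
wk-# ε               = ε
wk-# (w ▸ p)         = wk-# w ▸ there# p
wk-# (fresh r e f w) = fresh (there# r) (cong suc e) (λ i → cong suc (f i)) (wk-# w)

wk-id : ∀ {s} {Δ : SCtx s} → Wk Δ Δ (λ i → i)
wk-id {Δ = ε}     = ε
wk-id {Δ = Δ ▸ τ} = wk-▸ wk-id ▸ here
wk-id {Δ = Δ # α} = fresh here refl (λ _ → refl) wk-id

wk-lift▸ : ∀ {s t} {Δ : SCtx s} {Δ′ : SCtx t} {τ} {ρ : Ren s t} →
           Wk Δ Δ′ ρ → Wk (Δ ▸ τ) (Δ′ ▸ τ) (liftʳ ρ)
wk-lift▸ w = wk-▸ w ▸ here

wk-lift# : ∀ {s t} {Δ : SCtx s} {Δ′ : SCtx t} {α} {ρ : Ren s t} →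
           Wk Δ Δ′ ρ → Wk (Δ # α) (Δ′ # α) (liftʳ ρ)
wk-lift# w = fresh here refl (λ _ → refl) w

wk-∋ : ∀ {s t} {Δ : SCtx s} {Δ′ : SCtx t} {ρ : Ren s t} → Wk Δ Δ′ ρ →
       ∀ {x τ} → Δ ∋ˢ x ∶ τ → Δ′ ∋ˢ ρ x ∶ τ
wk-∋ (w ▸ p)         here       = p
wk-∋ (w ▸ _)         (there▸ q) = wk-∋ w q
wk-∋ (fresh r e f w) (there# q) = subst (_ ∋ˢ_∶ _) (sym (f _)) (incl-∋ r (wk-∋ w q))

consʳ : ∀ {s t l} → t ∋ l → Ren s t → Ren (l ∷ s) t
consʳ b ρ zero    = b
consʳ b ρ (suc i) = ρ i

record WkRestriction {s t u} (ρ : Ren s t) (Δ′ : SCtx t) (α : NConst) (a : s ∋ nm)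
                     (Δ₁ : SCtx u) (ι : Ren u s) : Set where
  constructor restricted
  field
    {scope}   : Scope
    {ctx}     : SCtx scope
    {image}   : t ∋ nm
    {ρ₁}      : Ren u scope
    at        : ρ a ≡ image
    r′        : Δ′ ⊢ image ∶ α ↘ ctx
    weakening : Wk Δ₁ ctx ρ₁
    square    : ∀ {k} (i : u ∋ k) → ρ (ι i) ≡ incl r′ (ρ₁ i)

-- A weakening induces one between the restrictions at a name and at its image. Every stability
-- property of concretion under change of world rests on this.
wk-restrict : ∀ {s t u} {Δ : SCtx s} {Δ′ : SCtx t} {ρ : Ren s t} → Wk Δ Δ′ ρ →
              ∀ {a α} {Δ₁ : SCtx u} (r : Δ ⊢ a ∶ α ↘ Δ₁) →
              WkRestriction ρ Δ′ α a Δ₁ (incl r)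
wk-restrict (fresh r e f w) here       = restricted e r w f
wk-restrict (w ▸ _)         (there▸ q) with wk-restrict w q
... | restricted e r w₁ f = restricted e r w₁ f
wk-restrict (fresh r e f w) (there# q) with wk-restrict w q
-- Here `q₁` restricts inside the context left by `r`. Swapping makes the restriction at the image
-- of `a` the outermost one; `b′` is `b` as seen inside it.
... | restricted {ρ₁ = ρ₁} e₁ q₁ w₁ f₁ with swap r q₁
... | swapped {b′ = b′} r₂ q₂ e₂ f₂ =
  restricted {ρ₁ = consʳ b′ (λ i → incl q₂ (ρ₁ i))}
    (trans (f _) (cong (incl r) e₁)) r₂ (fresh q₂ refl (λ _ → refl) w₁) λ where
      zero    → trans e (sym e₂)
      (suc i) → trans (f _) (trans (cong (incl r) (f₁ i)) (f₂ _))

wk-∘ : ∀ {s t u} {Δ : SCtx s} {Δ′ : SCtx t} {Δ″ : SCtx u} {ρ : Ren s t} {ρ′ : Ren t u} →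
       Wk Δ Δ′ ρ → Wk Δ′ Δ″ ρ′ → Wk Δ Δ″ (λ i → ρ′ (ρ i))
wk-∘ ε               w′ = ε
wk-∘ (w ▸ p)         w′ = wk-∘ w w′ ▸ wk-∋ w′ p
wk-∘ {ρ′ = ρ′} (fresh r e f w) w′ with wk-restrict w′ r
... | restricted e₁ r₁ w₁ f₁ =
  fresh r₁ (trans (cong ρ′ e) e₁) (λ i → trans (cong ρ′ (f i)) (f₁ _)) (wk-∘ w w₁)

wk-cons : ∀ {s t} {Δ : SCtx s} {a α} {Δ′ : SCtx t} (r : Δ ⊢ a ∶ α ↘ Δ′) →
          Wk (Δ′ # α) Δ (consʳ a (incl r))
wk-cons r = fresh r refl (λ _ → refl) wk-id

wk-incl : ∀ {s t} {Δ : SCtx s} {a α} {Δ′ : SCtx t} (r : Δ ⊢ a ∶ α ↘ Δ′) → Wk Δ′ Δ (incl r)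
-- Add a fresh name, then instantiate it by `a`; the composite renaming computes to `incl r`.
wk-incl r = wk-∘ (wk-# wk-id) (wk-cons r)

-- Algorithmic equivalence is a partial equivalence relation

⟶-ren : ∀ {s t} (ρ : Ren s t) {M M′ : Obj s} → M ⟶ M′ → ren ρ M ⟶ ren ρ M′
⟶-ren ρ {P} (β {M = M})  = subst (ren ρ P ⟶_) (sym (ren-inst M)) β
⟶-ren ρ {P} (βⁿ {M = M}) = subst (ren ρ P ⟶_) (sym (ren-instⁿ M)) βⁿ
⟶-ren ρ (app d)      = app (⟶-ren ρ d)
⟶-ren ρ (conc d)     = conc (⟶-ren ρ d)

⟶-deterministic : ∀ {s} {M M′ M″ : Obj s} → M ⟶ M′ → M ⟶ M″ → M′ ≡ M″
⟶-deterministic β        β        = refl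
⟶-deterministic βⁿ       βⁿ       = refl
⟶-deterministic (app d)  (app e)  = cong (_· _) (⟶-deterministic d e)
⟶-deterministic (conc d) (conc e) = cong (_＠ _) (⟶-deterministic d e)

data Neutral {s} : Obj s → Set where
  con  : ∀ {c} → Neutral (con c)
  var  : ∀ {x} → Neutral (var x)
  name : ∀ {a} → Neutral (name a)
  app  : ∀ {M N} → Neutral M → Neutral (M · N)
  conc : ∀ {M a} → Neutral M → Neutral (M ＠ a)

neutral-ren : ∀ {s t} (ρ : Ren s t) {M} → Neutral M → Neutral (ren ρ M)
neutral-ren ρ con      = con
neutral-ren ρ var      = var
neutral-ren ρ name     = name
neutral-ren ρ (app n)  = app (neutral-ren ρ n)
neutral-ren ρ (conc n) = conc (neutral-ren ρ n)

neutral-whnf : ∀ {s} {M M′ : Obj s} → Neutral M → ¬ (M ⟶ M′)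
neutral-whnf (app n)  (app d)  = neutral-whnf n d
neutral-whnf (conc n) (conc d) = neutral-whnf n d

mutual
  ⇔-sym : ∀ {Σ s} {Δ : SCtx s} {M N τ} → Σ ∣ Δ ⊢ M ⇔ N ∶ τ → Σ ∣ Δ ⊢ N ⇔ M ∶ τ
  ⇔-sym (whˡ δ d e)  = whʳ δ d (⇔-sym e)
  ⇔-sym (whʳ δ d e)  = whˡ δ d (⇔-sym e)
  ⇔-sym (struct δ d) = struct δ (↔-sym d)
  ⇔-sym (fun d)      = fun (⇔-sym d)
  ⇔-sym (abs d)      = abs (⇔-sym d)

  ↔-sym : ∀ {Σ s} {Δ : SCtx s} {M N τ} → Σ ∣ Δ ⊢ M ↔ N ∶ τ → Σ ∣ Δ ⊢ N ↔ M ∶ τ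
  ↔-sym (var p)    = var p
  ↔-sym (con p)    = con p
  ↔-sym (name p)   = name p
  ↔-sym (app d e)  = app (↔-sym d) (⇔-sym e)
  ↔-sym (conc r d) = conc r (↔-sym d)

↔-neutral : ∀ {Σ s} {Δ : SCtx s} {M N τ} → Σ ∣ Δ ⊢ M ↔ N ∶ τ → Neutral M
↔-neutral (var _)            = var
↔-neutral (con _)            = con
↔-neutral (name _)           = name
↔-neutral (app d _)          = app (↔-neutral d)
↔-neutral (conc {a = a} _ d) = conc (neutral-ren (thin a) (↔-neutral d))

∋ˢ-unique : ∀ {s} {Δ : SCtx s} {x τ τ′} → Δ ∋ˢ x ∶ τ → Δ ∋ˢ x ∶ τ′ → τ ≡ τ′
∋ˢ-unique here       here       = refl
∋ˢ-unique (there▸ p) (there▸ q) = ∋ˢ-unique p q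
∋ˢ-unique (there# p) (there# q) = ∋ˢ-unique p q

∋ⁿ-unique : ∀ {s} {Δ : SCtx s} {a α β} → Δ ∋ⁿ a ∶ α → Δ ∋ⁿ a ∶ β → α ≡ β
∋ⁿ-unique here       here       = refl
∋ⁿ-unique (there▸ p) (there▸ q) = ∋ⁿ-unique p q
∋ⁿ-unique (there# p) (there# q) = ∋ⁿ-unique p q

⧵-unique : ∀ {s} {Δ : SCtx s} {a α β Δ₁ Δ₂} →
           Δ ⊢ a ∶ α ⧵ Δ₁ → Δ ⊢ a ∶ β ⧵ Δ₂ → Δ₁ ≡ Δ₂
⧵-unique here       here       = refl
⧵-unique (there# r) (there# q) = cong (_# _) (⧵-unique r q)
⧵-unique (there▸ r) (there▸ q) = ⧵-unique r q

-- Well-formedness of the signature enters here: declarations are distinct, so a constant has one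
-- erased type and the types of neutral objects stay unique.
con-unique : ∀ {Σ c A B} → ⊢ˢ Σ → (c ∶ᵒ A) ∈ Σ → (c ∶ᵒ B) ∈ Σ → A ≡ B
con-unique (con _ _ _)  (here refl) (here refl) = refl
con-unique (con _ f _)  (here refl) (there q)   = ⊥-elim (f _ q)
con-unique (con _ f _)  (there p)   (here refl) = ⊥-elim (f _ p)
con-unique (con S _ _)  (there p)   (there q)   = con-unique S p q
con-unique (tcon S _ _) (there p)   (there q)   = con-unique S p q
con-unique (name S _)   (there p)   (there q)   = con-unique S p q

⟨⟩-injective : ∀ {α β τ υ} → (STy.⟨ α ⟩ τ) ≡ (⟨ β ⟩ υ) → τ ≡ υ
⟨⟩-injective refl = refl

＠-injective : ∀ {s} {M M′ : Obj s} {a b} → M ＠ a ≡ M′ ＠ b → M ≡ M′ × a ≡ b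
＠-injective refl = refl , refl

module _ {Σ : Sig} (S : ⊢ˢ Σ) where
  mutual
    -- Reductions of the outer objects are stripped off. If both derivations reduce the middle
    -- object, determinacy gives a common reduct; if one reduces it and the other treats it
    -- structurally, a neutral object would reduce.
    ⇔-trans : ∀ {s} {Δ : SCtx s} {M N P τ} →
              Σ ∣ Δ ⊢ M ⇔ N ∶ τ → Σ ∣ Δ ⊢ N ⇔ P ∶ τ → Σ ∣ Δ ⊢ M ⇔ P ∶ τ
    ⇔-trans (whˡ δ r d)  e            = whˡ δ r (⇔-trans d e)
    ⇔-trans (whʳ δ r d)  (whˡ _ q e) with ⟶-deterministic r q
    ... | refl = ⇔-trans d e
    ⇔-trans d@(whʳ _ _ _)  (whʳ δ q e)  = whʳ δ q (⇔-trans d e)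
    ⇔-trans (whʳ _ r _)  (struct _ e) = ⊥-elim (neutral-whnf (↔-neutral e) r)
    ⇔-trans (struct _ d) (whˡ _ q _)  = ⊥-elim (neutral-whnf (↔-neutral (↔-sym d)) q)
    ⇔-trans d@(struct _ _) (whʳ δ q e)  = whʳ δ q (⇔-trans d e)
    ⇔-trans (struct δ d) (struct _ e) with ↔-trans d e refl
    ... | _ , f = struct δ f
    ⇔-trans (fun d)      (fun e)      = fun (⇔-trans d e)
    ⇔-trans (abs d)      (abs e)      = abs (⇔-trans d e)

    -- The middle objects are only propositionally equal because, in the rule
    -- for concretion, they are images under a renaming.
    ↔-trans : ∀ {s} {Δ : SCtx s} {M N N′ P τ τ′} →
              Σ ∣ Δ ⊢ M ↔ N ∶ τ → Σ ∣ Δ ⊢ N′ ↔ P ∶ τ′ → N ≡ N′ →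
              τ ≡ τ′ × Σ ∣ Δ ⊢ M ↔ P ∶ τ
    ↔-trans (var p) (var q) refl = ∋ˢ-unique p q , var p
    ↔-trans (con p) (con q) refl = cong _⁻ (con-unique S p q) , con p
    ↔-trans (name p) (name q) refl = cong name (∋ⁿ-unique p q) , name p
    ↔-trans (app d d′) (app e e′) refl with ↔-trans d e refl
    ... | refl , f = refl , app f (⇔-trans d′ e′)
    ↔-trans (conc {a = a} r d) (conc q e) eq with ＠-injective eq
    -- The name fixes the restricted context, and injectivity of `thin a` makes the two middle
    -- objects below the concretion equal.
    ... | eq′ , refl with ⧵-unique r q | ren-injective (thin-injective a) eq′
    ... | refl | refl with ↔-trans d e refl
    ... | eq″ , f = ⟨⟩-injective eq″ , conc r f

-- Weakening of algorithmic equivalence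

mutual
  ⇔-wk : ∀ {Σ s t} {Δ : SCtx s} {Δ′ : SCtx t} {ρ : Ren s t} → Wk Δ Δ′ ρ →
         ∀ {M N τ} → Σ ∣ Δ ⊢ M ⇔ N ∶ τ → Σ ∣ Δ′ ⊢ ren ρ M ⇔ ren ρ N ∶ τ
  ⇔-wk w (whˡ δ r d)  = whˡ δ (⟶-ren _ r) (⇔-wk w d)
  ⇔-wk w (whʳ δ r d)  = whʳ δ (⟶-ren _ r) (⇔-wk w d)
  ⇔-wk w (struct δ d) = struct δ (↔-wk w d)
  ⇔-wk w {M} {N} (fun d) =
    fun (subst₂ (λ M N → _ ∣ _ ⊢ M · var zero ⇔ N · var zero ∶ _) (wk-ren M) (wk-ren N)
                (⇔-wk (wk-lift▸ w) d))
  ⇔-wk w {M} {N} (abs d) =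
    abs (subst₂ (λ M N → _ ∣ _ ⊢ M ＠ zero ⇔ N ＠ zero ∶ _) (wk-ren M) (wk-ren N)
                (⇔-wk (wk-lift# w) d))

  ↔-wk : ∀ {Σ s t} {Δ : SCtx s} {Δ′ : SCtx t} {ρ : Ren s t} → Wk Δ Δ′ ρ →
         ∀ {M N τ} → Σ ∣ Δ ⊢ M ↔ N ∶ τ → Σ ∣ Δ′ ⊢ ren ρ M ↔ ren ρ N ∶ τ
  ↔-wk w (var p)   = var (wk-∋ w p)
  ↔-wk w (con p)   = con p
  ↔-wk w (name p)  with ∋⇒↘ p
  ... | _ , _ , r with wk-restrict w r
  ... | restricted refl r′ _ _ = name (↘⇒∋ r′)
  ↔-wk w (app d e) = app (↔-wk w d) (⇔-wk w e)
  ↔-wk {ρ = ρ} w (conc {a = a} {M = M} {N} r d) with wk-restrict w (⧵⇒↘ r)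
  -- The premise is weakened into the restriction at `ρ a`, which `↘⇒⧵` returns to the scope that
  -- the rule for concretion prescribes.
  ... | restricted {ρ₁ = ρ₁} refl q w₁ f with ↘⇒⧵ q
  ... | from⧵ q′ =
    subst₂ (λ M N → _ ∣ _ ⊢ M ＠ _ ↔ N ＠ _ ∶ _) (ren-square square M) (ren-square square N)
           (conc q′ (↔-wk w₁ d))
    where
    square : ∀ {k} (i : _ ∋ k) → thin (ρ a) (ρ₁ i) ≡ ρ (thin a i)
    square i = trans (sym (incl-thin q′ _)) (trans (sym (f i)) (cong ρ (incl-thin r i)))

-- The logical relation

infix 5 _∣_⊢_∼_∶_

-- Since weakenings out of Δ # α include all instantiations of the last name,
-- the clause for ⟨ α ⟩ τ need not quantify over contexts.
_∣_⊢_∼_∶_ : ∀ (Σ : Sig) {s} → SCtx s → Obj s → Obj s → STy → Set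
Σ ∣ Δ ⊢ M ∼ N ∶ base a    = Σ ∣ Δ ⊢ M ⇔ N ∶ base a
Σ ∣ Δ ⊢ M ∼ N ∶ name α    = Σ ∣ Δ ⊢ M ⇔ N ∶ name α
Σ ∣ Δ ⊢ M ∼ N ∶ (⟨ α ⟩ τ) = Σ ∣ Δ # α ⊢ wk M ＠ zero ∼ wk N ＠ zero ∶ τ
Σ ∣ Δ ⊢ M ∼ N ∶ (τ₁ ⇒ τ₂) =
  ∀ {t} {Δ′ : SCtx t} {ρ : Ren _ t} → Wk Δ Δ′ ρ →
  ∀ {M′ N′} → Σ ∣ Δ′ ⊢ M′ ∼ N′ ∶ τ₁ → Σ ∣ Δ′ ⊢ ren ρ M · M′ ∼ ren ρ N · N′ ∶ τ₂

∼-resp : ∀ {Σ s} {Δ : SCtx s} {M M′ N N′} τ → M ≡ M′ → N ≡ N′ →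
         Σ ∣ Δ ⊢ M ∼ N ∶ τ → Σ ∣ Δ ⊢ M′ ∼ N′ ∶ τ
∼-resp τ refl refl m = m

∼-wk : ∀ {Σ s t} {Δ : SCtx s} {Δ′ : SCtx t} {ρ : Ren s t} → Wk Δ Δ′ ρ →
       ∀ {M N} τ → Σ ∣ Δ ⊢ M ∼ N ∶ τ → Σ ∣ Δ′ ⊢ ren ρ M ∼ ren ρ N ∶ τ
∼-wk w (base a) m = ⇔-wk w m
∼-wk w (name α) m = ⇔-wk w m
∼-wk w {M} {N} (τ₁ ⇒ τ₂) m w′ n =
  ∼-resp τ₂ (cong (_· _) (sym (ren-ren (λ _ → refl) M)))
            (cong (_· _) (sym (ren-ren (λ _ → refl) N)))
         (m (wk-∘ w w′) n)
∼-wk w {M} {N} (⟨ α ⟩ τ) m =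
  ∼-resp τ (cong (_＠ _) (wk-ren M)) (cong (_＠ _) (wk-ren N)) (∼-wk (wk-lift# w) τ m)

∼-expandˡ : ∀ {Σ s} {Δ : SCtx s} {M M′ N} τ → M ⟶ M′ →
            Σ ∣ Δ ⊢ M′ ∼ N ∶ τ → Σ ∣ Δ ⊢ M ∼ N ∶ τ
∼-expandˡ (base a)  r m     = whˡ base r m
∼-expandˡ (name α)  r m     = whˡ name r m
∼-expandˡ (τ₁ ⇒ τ₂) r m w n = ∼-expandˡ τ₂ (app (⟶-ren _ r)) (m w n)
∼-expandˡ (⟨ α ⟩ τ) r m     = ∼-expandˡ τ (conc (⟶-ren suc r)) m

∼-sym : ∀ {Σ s} {Δ : SCtx s} {M N} τ → Σ ∣ Δ ⊢ M ∼ N ∶ τ → Σ ∣ Δ ⊢ N ∼ M ∶ τ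
∼-sym (base a)  m     = ⇔-sym m
∼-sym (name α)  m     = ⇔-sym m
∼-sym (τ₁ ⇒ τ₂) m w n = ∼-sym τ₂ (m w (∼-sym τ₁ n))
∼-sym (⟨ α ⟩ τ) m     = ∼-sym τ m

∼-expand : ∀ {Σ s} {Δ : SCtx s} {M M′ N N′} τ → M ⟶ M′ → N ⟶ N′ →
           Σ ∣ Δ ⊢ M′ ∼ N′ ∶ τ → Σ ∣ Δ ⊢ M ∼ N ∶ τ
∼-expand τ r q m = ∼-expandˡ τ r (∼-sym τ (∼-expandˡ τ q (∼-sym τ m)))

mutual
  -- Both directions go by one induction on the simple type: at a function type, reading back needs
  -- a fresh variable to be related to itself at the domain, and reflecting a neutral function needs
  -- its related arguments to be algorithmically equivalent.
  ∼⇒⇔ : ∀ {Σ s} {Δ : SCtx s} {M N} τ → Σ ∣ Δ ⊢ M ∼ N ∶ τ → Σ ∣ Δ ⊢ M ⇔ N ∶ τ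
  ∼⇒⇔ (base a)  m = m
  ∼⇒⇔ (name α)  m = m
  ∼⇒⇔ (τ₁ ⇒ τ₂) m = fun (∼⇒⇔ τ₂ (m (wk-▸ wk-id) (↔⇒∼ τ₁ (var here))))
  ∼⇒⇔ (⟨ α ⟩ τ) m = abs (∼⇒⇔ τ m)

  ↔⇒∼ : ∀ {Σ s} {Δ : SCtx s} {M N} τ → Σ ∣ Δ ⊢ M ↔ N ∶ τ → Σ ∣ Δ ⊢ M ∼ N ∶ τ
  ↔⇒∼ (base a)  d     = struct base d
  ↔⇒∼ (name α)  d     = struct name d
  ↔⇒∼ (τ₁ ⇒ τ₂) d w n = ↔⇒∼ τ₂ (app (↔-wk w d) (∼⇒⇔ τ₁ n))
  ↔⇒∼ (⟨ α ⟩ τ) d     = ↔⇒∼ τ (conc here d)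

module _ {Σ : Sig} (S : ⊢ˢ Σ) where
  mutual
    ∼-trans : ∀ {s} {Δ : SCtx s} {M N P} τ →
              Σ ∣ Δ ⊢ M ∼ N ∶ τ → Σ ∣ Δ ⊢ N ∼ P ∶ τ → Σ ∣ Δ ⊢ M ∼ P ∶ τ
    ∼-trans (base a)  m n     = ⇔-trans S m n
    ∼-trans (name α)  m n     = ⇔-trans S m n
    -- The left argument serves in the middle as well; it is related to itself by symmetry and
    -- transitivity at the smaller type `τ₁`.
    ∼-trans (τ₁ ⇒ τ₂) m n w p = ∼-trans τ₂ (m w (∼-reflˡ τ₁ p)) (n w p)
    ∼-trans (⟨ α ⟩ τ) m n     = ∼-trans τ m n

    ∼-reflˡ : ∀ {s} {Δ : SCtx s} {M N} τ → Σ ∣ Δ ⊢ M ∼ N ∶ τ → Σ ∣ Δ ⊢ M ∼ M ∶ τ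
    ∼-reflˡ τ m = ∼-trans τ m (∼-sym τ m)

-- Related substitutions

-- Parallel to `Wk`, with objects as images of variables. No constructor fixes the form of the
-- substitutions, so environments can be replaced by pointwise equal ones.
data Env (Σ : Sig) : ∀ {s t} → SCtx s → SCtx t → Sub s t → Sub s t → Set where
  ε     : ∀ {t} {Δ : SCtx t} {σ θ : Sub [] t} → Env Σ ε Δ σ θ
  _▸_   : ∀ {s t} {Γ : SCtx s} {Δ : SCtx t} {τ} {σ θ : Sub (vr ∷ s) t} →
          Env Σ Γ Δ (λ i → σ (suc i)) (λ i → θ (suc i)) →
          Σ ∣ Δ ⊢ σ zero ∼ θ zero ∶ τ → Env Σ (Γ ▸ τ) Δ σ θ
  fresh : ∀ {s t u} {Γ : SCtx s} {Δ : SCtx t} {Δ′ : SCtx u} {α b}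
          {σ θ : Sub (nm ∷ s) t} {σ′ θ′ : Sub s u} →
          (r : Δ ⊢ b ∶ α ↘ Δ′) → σ zero ≡ b → θ zero ≡ b →
          (∀ {k} (i : s ∋ k) → σ (suc i) ≡ renImg k (incl r) (σ′ i)) →
          (∀ {k} (i : s ∋ k) → θ (suc i) ≡ renImg k (incl r) (θ′ i)) →
          Env Σ Γ Δ′ σ′ θ′ → Env Σ (Γ # α) Δ σ θ

env-sym : ∀ {Σ s t} {Γ : SCtx s} {Δ : SCtx t} {σ θ : Sub s t} →
          Env Σ Γ Δ σ θ → Env Σ Γ Δ θ σ
env-sym ε                     = ε
env-sym (_▸_ {τ = τ} E m)     = env-sym E ▸ ∼-sym τ m
env-sym (fresh r e e′ f f′ E) = fresh r e′ e f′ f (env-sym E)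

env-reflˡ : ∀ {Σ} → ⊢ˢ Σ → ∀ {s t} {Γ : SCtx s} {Δ : SCtx t} {σ θ : Sub s t} →
            Env Σ Γ Δ σ θ → Env Σ Γ Δ σ σ
env-reflˡ S ε                     = ε
env-reflˡ S (_▸_ {τ = τ} E m)     = env-reflˡ S E ▸ ∼-reflˡ S τ m
env-reflˡ S (fresh r e e′ f f′ E) = fresh r e e f f (env-reflˡ S E)

env-wk : ∀ {Σ s t u} {Γ : SCtx s} {Δ : SCtx t} {Δ′ : SCtx u} {ρ : Ren t u} {σ θ : Sub s t} →
         Wk Δ Δ′ ρ → Env Σ Γ Δ σ θ → Env Σ Γ Δ′ (renSub ρ σ) (renSub ρ θ)
env-wk w ε                 = ε
env-wk w (_▸_ {τ = τ} E m) = env-wk w E ▸ ∼-wk w τ m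
env-wk {ρ = ρ} w (fresh r e e′ f f′ E) with wk-restrict w r
... | restricted e₁ r₁ w₁ f₁ =
  fresh r₁ (trans (cong ρ e) e₁) (trans (cong ρ e′) e₁)
        (λ {k} i → trans (cong (renImg k ρ) (f i)) (renImg-square k f₁ _))
        (λ {k} i → trans (cong (renImg k ρ) (f′ i)) (renImg-square k f₁ _))
        (env-wk w₁ E)

env-var : ∀ {Σ s t} {Γ : SCtx s} {Δ : SCtx t} {σ θ : Sub s t} → Env Σ Γ Δ σ θ →
          ∀ {x τ} → Γ ∋ˢ x ∶ τ → Σ ∣ Δ ⊢ σ x ∼ θ x ∶ τ
env-var (E ▸ m)               here       = m
env-var (E ▸ _)               (there▸ p) = env-var E p
env-var (fresh r e e′ f f′ E) {τ = τ} (there# p) =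
  -- Images of earlier variables are related in the restricted world and are carried back along its
  -- inclusion.
  ∼-resp τ (sym (f _)) (sym (f′ _)) (∼-wk (wk-incl r) τ (env-var E p))

record EnvRestriction Σ {s t u} (σ θ : Sub s t) (Δ : SCtx t) (α : NConst) (a : s ∋ nm)
                      (Γ₁ : SCtx u) (ι : Ren u s) : Set where
  constructor restricted
  field
    {scope} : Scope
    {ctx}   : SCtx scope
    {image} : t ∋ nm
    {σ₁ θ₁} : Sub u scope
    atˡ     : σ a ≡ image
    atʳ     : θ a ≡ image
    r′      : Δ ⊢ image ∶ α ↘ ctx
    env     : Env Σ Γ₁ ctx σ₁ θ₁
    squareˡ : ∀ {k} (i : u ∋ k) → σ (ι i) ≡ renImg k (incl r′) (σ₁ i)
    squareʳ : ∀ {k} (i : u ∋ k) → θ (ι i) ≡ renImg k (incl r′) (θ₁ i)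

-- The argument of `wk-restrict`, for related substitutions. It supplies the premise of a concretion
-- rule, which lives over a restricted context, with an environment into a restricted world.
env-restrict : ∀ {Σ s t u} {Γ : SCtx s} {Δ : SCtx t} {σ θ : Sub s t} → Env Σ Γ Δ σ θ →
               ∀ {a α} {Γ₁ : SCtx u} (r : Γ ⊢ a ∶ α ↘ Γ₁) →
               EnvRestriction Σ σ θ Δ α a Γ₁ (incl r)
env-restrict (fresh r e e′ f f′ E) here = restricted e e′ r E f f′
env-restrict (E ▸ _) (there▸ q) with env-restrict E q
... | restricted e e′ r E₁ f f′ = restricted e e′ r E₁ f f′
env-restrict (fresh r e e′ f f′ E) (there# q) with env-restrict E q
... | restricted {σ₁ = σ₁} {θ₁} e₁ e₁′ q₁ E₁ f₁ f₁′ with swap r q₁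
... | swapped {b′ = b′} r₂ q₂ e₂ f₂ =
  restricted {σ₁ = extˢ b′ (renSub (incl q₂) σ₁)} {θ₁ = extˢ b′ (renSub (incl q₂) θ₁)}
    (trans (f _) (cong (incl r) e₁)) (trans (f′ _) (cong (incl r) e₁′)) r₂
    (fresh q₂ refl refl (λ _ → refl) (λ _ → refl) E₁)
    (λ where
      zero        → trans e (sym e₂)
      {k} (suc i) → trans (f _) (trans (cong (renImg k (incl r)) (f₁ i)) (renImg-square k f₂ _)))
    (λ where
      zero        → trans e′ (sym e₂)
      {k} (suc i) → trans (f′ _) (trans (cong (renImg k (incl r)) (f₁′ i)) (renImg-square k f₂ _)))

env-lift# : ∀ {Σ s t} {Γ : SCtx s} {Δ : SCtx t} {α} {σ θ : Sub s t} →
            Env Σ Γ Δ σ θ → Env Σ (Γ # α) (Δ # α) (liftˢ σ) (liftˢ θ)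
env-lift# E = fresh here refl refl (λ { {vr} _ → refl ; {nm} _ → refl })
                                   (λ { {vr} _ → refl ; {nm} _ → refl }) E

env-resp : ∀ {Σ s t} {Γ : SCtx s} {Δ : SCtx t} {σ σ′ θ θ′ : Sub s t} →
           (∀ {k} (i : s ∋ k) → σ i ≡ σ′ i) → (∀ {k} (i : s ∋ k) → θ i ≡ θ′ i) →
           Env Σ Γ Δ σ θ → Env Σ Γ Δ σ′ θ′
env-resp g g′ ε       = ε
env-resp g g′ (_▸_ {τ = τ} E m) =
  env-resp (λ i → g (suc i)) (λ i → g′ (suc i)) E ▸ ∼-resp τ (g zero) (g′ zero) m
env-resp g g′ (fresh r e e′ f f′ E) =
  fresh r (trans (sym (g zero)) e) (trans (sym (g′ zero)) e′)
        (λ i → trans (sym (g (suc i))) (f i)) (λ i → trans (sym (g′ (suc i))) (f′ i)) E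

env-id : ∀ {Σ s} {Γ : SCtx s} → Env Σ Γ Γ (λ {k} i → fromIndex k i) (λ {k} i → fromIndex k i)
env-id {Γ = ε}     = ε
env-id {Γ = Γ ▸ τ} =
  env-resp (λ { {vr} _ → refl ; {nm} _ → refl }) (λ { {vr} _ → refl ; {nm} _ → refl })
           (env-wk (wk-▸ wk-id) env-id)
  ▸ ↔⇒∼ τ (var here)
env-id {Γ = Γ # α} = fresh here refl refl (λ { {vr} _ → refl ; {nm} _ → refl })
                                          (λ { {vr} _ → refl ; {nm} _ → refl }) env-id

-- Substitution identities for the fundamental theorem

liftʳ-liftˢ-inst : ∀ {s t u} {σ : Sub s t} {ρ : Ren t u} {N : Obj u} (M : Obj (vr ∷ s)) →
                    ren (liftʳ ρ) (sub (liftˢ σ) M) [ N ] ≡ sub (extˢ N (renSub ρ σ)) M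
liftʳ-liftˢ-inst {σ = σ} {ρ} {N} M =
  trans (cong _[ N ] (ren-sub (renImg-liftˢ (λ _ → refl)) M)) (liftˢ-inst M)

extˢ-renSub-wk : ∀ {s t u} {σ : Sub s t} {ρ : Ren t u} {N : Obj u} (M : Obj s) →
                  sub (extˢ N (renSub ρ σ)) (wk M) ≡ ren ρ (sub σ M)
extˢ-renSub-wk M = trans (sub-ren (λ _ → refl) M) (sym (ren-sub (λ _ → refl) M))

sub-wk : ∀ {s t l} {σ : Sub s t} (M : Obj s) → sub (liftˢ {l = l} σ) (wk M) ≡ wk (sub σ M)
sub-wk {σ = σ} M =
  trans (sub-ren (λ _ → refl) M)
        (sym (ren-sub (λ { {vr} _ → refl ; {nm} _ → refl }) M))

wk-instⁿ : ∀ {s} (M : Obj (nm ∷ s)) → ren (liftʳ suc) M [ zero ]ⁿ ≡ M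
wk-instⁿ M = trans (ren-ren (λ { zero → refl ; (suc i) → refl }) M) (ren-id (λ _ → refl) M)

⁻-instⁿ-thin : ∀ {s} (b : s ∋ nm) (A : Ty (nm ∷ (s ∖ b))) →
               (renᵗ (liftʳ (thin b)) A [ b ]ⁿᵗ) ⁻ ≡ A ⁻
⁻-instⁿ-thin b A = trans (⁻-ren (instⁿ b) (renᵗ (liftʳ (thin b)) A)) (⁻-ren (liftʳ (thin b)) A)

extˢ-liftʳ : ∀ {s t u l} {σ : Sub s t} {ρ : Ren u s} {x : Img l t} →
             ∀ {k} (i : (l ∷ u) ∋ k) →
             extˢ x σ (liftʳ ρ i) ≡ extˢ {l = l} x (λ j → σ (ρ j)) i
extˢ-liftʳ zero    = refl
extˢ-liftʳ (suc i) = refl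

-- With `sub-instⁿ-ren`, this presents the contractum and the right-hand side of the rule `βⁿ` as
-- substitutions that send the bound name directly to its image.
sub-lift-instⁿ : ∀ {s t u} {σ : Sub s t} {ρ : Ren u s} {b : t ∋ nm} (M : Obj (nm ∷ u)) →
                 sub (liftˢ σ) (ren (liftʳ ρ) M) [ b ]ⁿ ≡ sub (extˢ b (λ i → σ (ρ i))) M
sub-lift-instⁿ {ρ = ρ} M =
  trans (liftˢ-instⁿ (ren (liftʳ ρ) M)) (sub-ren extˢ-liftʳ M)

sub-instⁿ-ren : ∀ {s t u} {σ : Sub s t} {ρ : Ren u s} {b : s ∋ nm} (M : Obj (nm ∷ u)) →
                sub σ (ren (liftʳ ρ) M [ b ]ⁿ) ≡ sub (extˢ (σ b) (λ i → σ (ρ i))) M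
sub-instⁿ-ren {ρ = ρ} {b} M =
  trans (cong (sub _) (ren-ren {ρ″ = consʳ b ρ} (λ { zero → refl ; (suc i) → refl }) M))
        (sub-ren (λ { zero → refl ; (suc i) → refl }) M)

-- Weakening by a fresh name and then instantiating it leaves only `κ`, here the inclusion of a
-- restricted world. So an object substituted in that world agrees with its inclusion substituted in
-- the full one.
sub-restricted : ∀ {s t u v} {σ : Sub s t} {ι : Ren u s} {b : t ∋ nm} {κ : Ren v t} {σ₁ : Sub u v} →
                 ∀ M → (∀ {k} (i : u ∋ k) → σ (ι i) ≡ renImg k κ (σ₁ i)) →
                 ren (consʳ b κ) (wk (sub σ₁ M)) ≡ sub σ (ren ι M)
sub-restricted {κ = κ} {σ₁} M f =
  trans (ren-ren {ρ″ = κ} (λ _ → refl) (sub σ₁ M))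
        (trans (ren-sub {θ = renSub κ σ₁} (λ _ → refl) M) (sym (sub-ren f M)))

-- The fundamental theorem and completeness

-- By induction on the equality derivation. The two sides receive different, related substitutions,
-- since the rules that go under a variable binder extend the environment by a pair of related
-- arguments.
fundamental : ∀ {Σ} → ⊢ˢ Σ → ∀ {s t} {Γ : Ctx s} {Δ : SCtx t} {M N A} →
              Σ ∣ Γ ⊢ᵒ M ≐ N ∶ A → ∀ {σ θ : Sub s t} → Env Σ (Γ ⁻ᶜ) Δ σ θ →
              Σ ∣ Δ ⊢ sub σ M ∼ sub θ N ∶ (A ⁻)
fundamental S (≐-sym {A = A} d) E = ∼-sym (A ⁻) (fundamental S d (env-sym E))
fundamental S (≐-trans {A = A} d e) E =
  -- The first premise is taken with `σ` on both sides, so that the two halves meet at the same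
  -- substituted object.
  ∼-trans S (A ⁻) (fundamental S d (env-reflˡ S E)) (fundamental S e E)
fundamental S (conv d e) E = subst (_ ∣ _ ⊢ _ ∼ _ ∶_) (⁻-≐ e) (fundamental S d E)
fundamental S (var _ p) E = env-var E (⁻-∋ p)
fundamental S (con {A = A} _ p) E =
  subst (_ ∣ _ ⊢ _ ∼ _ ∶_) (sym (⁻-ren ∅ A)) (↔⇒∼ (A ⁻) (con p))
fundamental S (app {M₁} {M₂} {N₁} {N₂} {A} {B} d e) {σ} {θ} E =
  subst (_ ∣ _ ⊢ _ ∼ _ ∶_) (sym (⁻-sub (inst M₂) B))
    (∼-resp (B ⁻) (cong (_· _) (ren-id (λ _ → refl) (sub σ M₁)))
                  (cong (_· _) (ren-id (λ _ → refl) (sub θ N₁)))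
      (fundamental S d E wk-id (fundamental S e E)))
fundamental S (lam {B = B} {M} {N} _ _ d) E w {M′} {N′} n =
  ∼-expand (B ⁻) β β
    (∼-resp (B ⁻) (sym (liftʳ-liftˢ-inst M)) (sym (liftʳ-liftˢ-inst N))
      (fundamental S d {extˢ M′ _} {extˢ N′ _} (env-wk w E ▸ n)))
fundamental S (β {B = B} {M₁} {M₂} {N₁} {N₂} _ d e) {σ} {θ} E =
  subst (_ ∣ _ ⊢ _ ∼ _ ∶_) (sym (⁻-sub (inst M₁) B))
    (∼-expandˡ (B ⁻) β
      (∼-resp (B ⁻) (sym (liftˢ-inst M₂)) (sym (sub-inst N₂))
        (fundamental S d {extˢ (sub σ M₁) σ} {extˢ (sub θ N₁) θ} (E ▸ fundamental S e E))))
fundamental S (ext {A} {B} {M} {N} _ _ _ d) E w {M′} {N′} n =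
  -- Under the extended environment `var zero` becomes the argument while `wk M` and `wk N` ignore
  -- the new entry, so the premise already has the shape of the goal.
  ∼-resp (B ⁻) (cong (_· _) (extˢ-renSub-wk M)) (cong (_· _) (extˢ-renSub-wk N))
    (fundamental S d {extˢ M′ _} {extˢ N′ _} (env-wk w E ▸ n))
fundamental S (name _ p) E with ∋⇒↘ (⁻-∋ⁿ p)
... | _ , _ , r with env-restrict E r
... | restricted e e′ r′ _ _ _ =
  ∼-resp (name _) (cong name (sym e)) (cong name (sym e′)) (struct name (name (↘⇒∋ r′)))
fundamental S (abs {A = A} {M} {N} d) E =
  ∼-expand (A ⁻) βⁿ βⁿ
    -- Each side contracts by instantiating the bound name with the fresh name of the world, which
    -- restores the body.
    (∼-resp (A ⁻) (sym (wk-instⁿ _)) (sym (wk-instⁿ _)) (fundamental S d (env-lift# E)))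
fundamental S (conc {b} {A = A} {M} {N} _ r d) {σ} {θ} E
  with env-restrict E (⧵⇒↘ (⁻-⧵ r))
... | restricted e e′ r′ E₁ f f′ =
  subst (_ ∣ _ ⊢ _ ∼ _ ∶_) (sym (⁻-instⁿ-thin b A))
    (∼-resp (A ⁻)
      (cong₂ _＠_ (sub-restricted M λ i → trans (cong σ (sym (incl-thin (⁻-⧵ r) i))) (f i)) (sym e))
      (cong₂ _＠_ (sub-restricted N λ i → trans (cong θ (sym (incl-thin (⁻-⧵ r) i))) (f′ i)) (sym e′))
      -- The induction hypothesis speaks of a fresh name over the restricted world; `wk-cons`
      -- instantiates that name by the image of `b`.
      (∼-wk (wk-cons r′) (A ⁻) (fundamental S d E₁)))
fundamental S (βⁿ {b} {A = A} {M} {N} _ r d) {σ} {θ} E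
  with env-restrict E (⧵⇒↘ (⁻-⧵ r))
... | restricted e e′ r′ E₁ f f′ =
  subst (_ ∣ _ ⊢ _ ∼ _ ∶_) (sym (⁻-instⁿ-thin b A))
    (∼-expandˡ (A ⁻) βⁿ
      (∼-resp (A ⁻) (sym (sub-lift-instⁿ M)) (sym (sub-instⁿ-ren N))
        -- The bound name is sent straight to the image of `b`. This is a legitimate environment
        -- because everything before it already factors through the restriction at that image.
        (fundamental S d
          (fresh {σ = extˢ (σ b) (λ i → σ (thin b i))} {extˢ (θ b) (λ i → θ (thin b i))} r′ e e′
            (λ i → trans (cong σ (sym (incl-thin (⁻-⧵ r) i))) (f i))
            (λ i → trans (cong θ (sym (incl-thin (⁻-⧵ r) i))) (f′ i)) E₁))))
fundamental S (extⁿ {A = A} {M} {N} d) E =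
  ∼-resp (A ⁻) (cong (_＠ _) (sub-wk M)) (cong (_＠ _) (sub-wk N)) (fundamental S d (env-lift# E))

theorem4p12 : ∀ {Σ : Sig} {s : Scope} {Γ : Ctx s} {M N : Obj s} {A : Ty s} →
    ⊢ˢ Σ → Σ ⊢ᶜ Γ → Σ ∣ Γ ⊢ᵒ M ≐ N ∶ A → Σ ∣ Γ ⁻ᶜ ⊢ M ⇔ N ∶ (A ⁻)
theorem4p12 {M = M} {N} {A} S _ d =
  ∼⇒⇔ (A ⁻) (∼-resp (A ⁻) (sub-id (λ _ → refl) M) (sub-id (λ _ → refl) N) (fundamental S d env-id))
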